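{- Let $\mathcal{H}$ be a set of two connected graphs, each of order at least $3$. If there exists a positive integer $n_0=n_0(\mathcal{H})$ such that every $2$-connected $\mathcal{H}$-free graph of order at least $n_0$ has a dominating cycle, then $\mathcal{H}\le \mathcal{H}_i$ for some $i$ with $1\le i\le 7$, where $\mathcal{H}_1=\{K_{1,3},Z_4\}$, $\mathcal{H}_2=\{K_{1,3},B_{1,2}\}$, $\mathcal{H}_3=\{K_{1,3},N_{1,1,1}\}$, $\mathcal{H}_4=\{P_4,W\}$, $\mathcal{H}_5=\{K_{1,3}^{*},Z_1\}$, $\mathcal{H}_6=\{P_5,W^{*}\}$, $\mathcal{H}_7=\{P_5,K_4^{ - }\}$.
   Context: All graphs are finite and simple. A cycle $C$ in a graph $G$ is dominating if every edge of $G$ has at least one end vertex on $C$. For a set $\mathcal{H}$ of connected graphs, $G$ is $\mathcal{H}$-free if $G$ contains no member of $\mathcal{H}$ as an induced subgraph. For graphs $H_1,H_2$, write $H_1\prec H_2$ if $H_1$ is an induced subgraph of $H_2$; for sets $\mathcal{H}_1,\mathcal{H}_2$ of connected graphs, $\mathcal{H}_1\le\mathcal{H}_2$ means that for every $H_2\in\mathcal{H}_2$ there is $H_1\in\mathcal{H}_1$ with $H_1\prec H_2$. $P_n$ is the path of order $n$, $K_n$ the complete graph, $K_{1,3}$ the claw. $Z_n$ is obtained from a triangle by attaching a path with $n$ new vertices at one triangle vertex (i.e. identifying an end of $P_{n+1}$ with a triangle vertex). $B_{m,n}$ is obtained from a triangle $abc$ by attaching a path of $m$ new vertices at $a$ and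 a path of $n$ new vertices at $b$. $N_{l,m,n}$ is obtained from a triangle $abc$ by attaching paths of $l$, $m$, $n$ new vertices at $a$, $b$, $c$ respectively. $K_{1,3}^{*}$ is the graph obtained from $K_{1,3}$ by subdividing each edge once. $W=K_1+3K_2$ (one vertex joined to all vertices of three disjoint edges), $W^{*}=K_1+(K_1\cup 2K_2)$, and $K_4^{ - }$ is $K_4$ minus one edge. Here $+$ denotes join and $\cup$ disjoint union. -}

module Defs where

open import Data.Nat using (ℕ; zero; suc; _≤_; _≡ᵇ_)
open import Data.Fin using (Fin; toℕ; inject₁; fromℕ; _≟_)
import Data.Fin as F
open import Data.Bool using (Bool; true; false; _∧_; _∨_; not)
open import Data.Bool.Properties using (∨-comm)
open import Data.List using (List; []; _∷_)
open import Data.Bool.ListAction using (any)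
open import Data.Product using (Σ; ∃; _×_; _,_)
open import Data.Sum using (_⊎_)
open import Data.Unit using (⊤)
open import Relation.Nullary using (¬_; does; yes; no)
open import Relation.Binary.PropositionalEquality using (_≡_; _≢_; refl)
open import Function.Definitions using (Injective)

record Graph : Set where
  field
    order  : ℕ
    adj    : Fin order → Fin order → Bool
    sym    : ∀ u v → adj u v ≡ adj v u
    irrefl : ∀ u → adj u u ≡ false
open Graph public

Adj : (G : Graph) → Fin (order G) → Fin (order G) → Set
Adj G u v = adj G u v ≡ true

data WalkIn (G : Graph) (P : Fin (order G) → Set) : Fin (order G) → Fin (order G) → Set where
  here : ∀ {u} → P u → WalkIn G P u u
  step : ∀ {u v w} → P u → Adj G u v → WalkIn G P v w → WalkIn G P u w

Connected : Graph → Set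
Connected G = ∀ u v → WalkIn G (λ _ → ⊤) u v

TwoConnected : Graph → Set
TwoConnected G =
  (3 ≤ order G) × Connected G ×
  (∀ x u v → u ≢ x → v ≢ x → WalkIn G (λ y → y ≢ x) u v)

record Cycle (G : Graph) : Set where
  field
    len-2   : ℕ
    vtx     : Fin (suc (suc (suc len-2))) → Fin (order G)
    distinct : Injective _≡_ _≡_ vtx
    consec  : ∀ (i : Fin (suc (suc len-2))) → Adj G (vtx (inject₁ i)) (vtx (F.suc i))
    closing : Adj G (vtx (fromℕ (suc (suc len-2)))) (vtx F.zero)
open Cycle public

OnCycle : {G : Graph} → Cycle G → Fin (order G) → Set
OnCycle C u = ∃ λ i → vtx C i ≡ u

Dominating : {G : Graph} → Cycle G → Set
Dominating {G} C = ∀ u v → Adj G u v → OnCycle C u ⊎ OnCycle C v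

HasDominatingCycle : Graph → Set
HasDominatingCycle G = Σ (Cycle G) Dominating

_≺_ : Graph → Graph → Set
H ≺ G = Σ (Fin (order H) → Fin (order G)) λ f →
          Injective _≡_ _≡_ f × (∀ u v → adj H u v ≡ adj G (f u) (f v))

_≅_ : Graph → Graph → Set
H ≅ G = Σ (Fin (order H) → Fin (order G)) λ f →
        Σ (Fin (order G) → Fin (order H)) λ g →
          (∀ x → g (f x) ≡ x) × (∀ y → f (g y) ≡ y) ×
          (∀ u v → adj H u v ≡ adj G (f u) (f v))

Free₂ : Graph → Graph → Graph → Set
Free₂ H₁ H₂ G = ¬ (H₁ ≺ G) × ¬ (H₂ ≺ G)

Le₂ : Graph → Graph → Graph → Graph → Set
Le₂ H₁ H₂ A B = (H₁ ≺ A ⊎ H₂ ≺ A) × (H₁ ≺ B ⊎ H₂ ≺ B)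

private
  base : ∀ {n} → List (ℕ × ℕ) → Fin n → Fin n → Bool
  base es u v = not (does (u ≟ v)) ∧
    any (λ { (a , b) → (toℕ u ≡ᵇ a) ∧ (toℕ v ≡ᵇ b) }) es

  base-irr : ∀ {n} (es : List (ℕ × ℕ)) (u : Fin n) → base es u u ≡ false
  base-irr es u with u ≟ u
  ... | yes _ = refl
  ... | no ¬p with ¬p refl
  ... | ()

fromEdges : (n : ℕ) → List (ℕ × ℕ) → Graph
fromEdges n es = record
  { order  = n
  ; adj    = λ u v → base es u v ∨ base es v u
  ; sym    = λ u v → ∨-comm (base es u v) (base es v u)
  ; irrefl = λ u → irr u
  }
  where
  irr : ∀ u → (base es u u ∨ base es u u) ≡ false
  irr u rewrite base-irr es u = refl

P₄ P₅ K₁₃ Z₁ Z₄ B₁₂ N₁₁₁ W W* K₁₃* K₄⁻ : Graph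
P₄   = fromEdges 4 ((0 , 1) ∷ (1 , 2) ∷ (2 , 3) ∷ [])
P₅   = fromEdges 5 ((0 , 1) ∷ (1 , 2) ∷ (2 , 3) ∷ (3 , 4) ∷ [])
K₁₃  = fromEdges 4 ((0 , 1) ∷ (0 , 2) ∷ (0 , 3) ∷ [])
Z₁   = fromEdges 4 ((0 , 1) ∷ (0 , 2) ∷ (1 , 2) ∷ (0 , 3) ∷ [])
Z₄   = fromEdges 7 ((0 , 1) ∷ (0 , 2) ∷ (1 , 2) ∷ (0 , 3) ∷ (3 , 4) ∷ (4 , 5) ∷ (5 , 6) ∷ [])
B₁₂  = fromEdges 6 ((0 , 1) ∷ (0 , 2) ∷ (1 , 2) ∷ (0 , 3) ∷ (1 , 4) ∷ (4 , 5) ∷ [])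
N₁₁₁ = fromEdges 6 ((0 , 1) ∷ (0 , 2) ∷ (1 , 2) ∷ (0 , 3) ∷ (1 , 4) ∷ (2 , 5) ∷ [])
-- K₁ + 3K₂ : centre 0, edges 12, 34, 56
W    = fromEdges 7 ((0 , 1) ∷ (0 , 2) ∷ (0 , 3) ∷ (0 , 4) ∷ (0 , 5) ∷ (0 , 6) ∷
                    (1 , 2) ∷ (3 , 4) ∷ (5 , 6) ∷ [])
-- K₁ + (K₁ ∪ 2K₂) : centre 0, isolated-in-rest vertex 1, edges 23, 45
W*   = fromEdges 6 ((0 , 1) ∷ (0 , 2) ∷ (0 , 3) ∷ (0 , 4) ∷ (0 , 5) ∷
                    (2 , 3) ∷ (4 , 5) ∷ [])
-- claw with each edge subdivided once: centre 0, legs 0-1-2, 0-3-4, 0-5-6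
K₁₃* = fromEdges 7 ((0 , 1) ∷ (1 , 2) ∷ (0 , 3) ∷ (3 , 4) ∷ (0 , 5) ∷ (5 , 6) ∷ [])
K₄⁻  = fromEdges 4 ((0 , 1) ∷ (0 , 2) ∷ (0 , 3) ∷ (1 , 2) ∷ (1 , 3) ∷ [])

{-# OPTIONS --safe #-}
-- A large 2-connected graph without a dominating cycle contains H₁ or H₂ as an induced subgraph. This is
-- applied to nine families of such graphs: a cycle in one of them misses one of three parts that all contain
-- an edge. Let neither graph be contained in the claw (otherwise the claw-free families 𝒞₂, 𝒞₃ and the long
-- ladders between two triangles confine the other one to Z₄, B₁₂ or N₁₁₁). One of them, say H₂, embeds in
-- K₂ + 3Kₙ, so it has a triangle; hence H₁ embeds in ℰ and in long theta graphs, which confines it to K₁₃*,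
-- and H₂ embeds in the P₄-free families as well, which confines it to W or K₄⁻. If H₁ embeds in a claw-free
-- family, then H₁ is a path and 𝒬 decides between P₄ and P₅; otherwise H₂ does, and it is confined to Z₁.
--
-- Each confinement is a finite computation. A list of connected graphs containing K₁ and closed under
-- one-vertex extensions avoiding the forbidden subgraphs contains every connected graph avoiding them. A graph
-- is not contained in any blow-up of a pattern if its vertices cannot be typed by the nodes of the pattern, and
-- a ladder can be shortened by deleting unused levels until it is no longer than the graph requires.
module Submission where

open import Defs
open import Data.Nat as ℕ
  using (ℕ; zero; suc; _≤_; _<_; _+_; _*_; _∸_; z≤n; s≤s; _≡ᵇ_; ⌊_/2⌋)
import Data.Nat.Properties as ℕₚ
open import Data.Fin as Fin
  using (Fin; zero; suc; _≟_; toℕ; fromℕ; fromℕ<; inject₁; _↑ˡ_; _↑ʳ_; splitAt; join; combine; remQuot)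
open import Data.Fin.Patterns
open import Data.Fin.Properties
  using (any?; all?; ¬∀⟶∃¬; pigeonhole; injective⇒≤; suc-injective; toℕ<n; toℕ-injective; toℕ-fromℕ<;
         splitAt-↑ˡ; splitAt-↑ʳ; join-splitAt; ↑ˡ-injective; ↑ʳ-injective;
         remQuot-combine; combine-remQuot; combine-injective)
open import Data.Bool using (Bool; true; false; _∧_; _∨_; not; T; _xor_; if_then_else_)
open import Data.Bool.Properties using (T-∧; T-∨; T-≡; T-not-≡; ∨-comm; ∧-comm; ∧-zeroʳ)
open import Data.Bool.ListAction using (any; all)
open import Data.List using (List; []; _∷_; map)
open import Data.List.Relation.Unary.All as All using (All; []; _∷_)
open import Data.List.Relation.Unary.All.Properties as All using (all⁺; ++⁺)
open import Data.List.Relation.Unary.Any as Any using (Any; here; there)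
open import Data.List.Relation.Unary.Any.Properties as Any using (any⁻)
open import Data.List.Membership.Propositional using (_∈_; find)
open import Data.Vec as Vec using (Vec; []; _∷_; lookup; tabulate)
open import Data.Vec.Properties using (lookup∘tabulate; lookup-zipWith)
open import Data.Product using (Σ; ∃; _×_; _,_; proj₁; proj₂; map₂; uncurry)
open import Data.Sum as Sum using (_⊎_; inj₁; inj₂; [_,_]′; swap)
open import Data.Sum.Properties using (inj₂-injective)
open import Data.Empty using (⊥; ⊥-elim)
open import Data.Unit using (⊤; tt)
open import Function using (_∘_; id; Equivalence; case_of_)
open import Function.Definitions using (Injective)
open import Relation.Nullary using (¬_; ¬?; Dec; yes; no; does; contradiction; map′)
open import Relation.Nullary.Decidable using (T?; decidable-stable)
open import Relation.Binary.Definitions using (tri<; tri≈; tri>)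
open import Relation.Binary.PropositionalEquality
  using (_≡_; _≢_; refl; cong; cong₂; trans; subst; subst₂) renaming (sym to ≡-sym)

open Equivalence using (to; from)

-- Boolean quantifiers over finite sets.

allF : ∀ {n} → (Fin n → Bool) → Bool
allF {zero}  p = true
allF {suc n} p = p zero ∧ allF (p ∘ suc)

anyF : ∀ {n} → (Fin n → Bool) → Bool
anyF {zero}  p = false
anyF {suc n} p = p zero ∨ anyF (p ∘ suc)

allF⁻ : ∀ {n} (p : Fin n → Bool) → T (allF p) → ∀ i → T (p i)
allF⁻ p t zero    = proj₁ (to T-∧ t)
allF⁻ p t (suc i) = allF⁻ (p ∘ suc) (proj₂ (to T-∧ t)) i

allF⁺ : ∀ {n} (p : Fin n → Bool) → (∀ i → T (p i)) → T (allF p)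
allF⁺ {zero}  p h = tt
allF⁺ {suc n} p h = from T-∧ (h zero , allF⁺ (p ∘ suc) (h ∘ suc))

anyF⁺ : ∀ {n} (p : Fin n → Bool) i → T (p i) → T (anyF p)
anyF⁺ p zero    t = from T-∨ (inj₁ t)
anyF⁺ p (suc i) t = from T-∨ (inj₂ (anyF⁺ (p ∘ suc) i t))

anyF⁻ : ∀ {n} (p : Fin n → Bool) → T (anyF p) → ∃ λ i → T (p i)
anyF⁻ {suc n} p t with to T-∨ t
... | inj₁ t₀ = zero , t₀
... | inj₂ t₁ with anyF⁻ (p ∘ suc) t₁
...   | i , tᵢ = suc i , tᵢ

T-not : ∀ {b} → T (not b) → ¬ T b
T-not {false} _ ()

T-not⁻ : ∀ {b} → ¬ T b → T (not b)
T-not⁻ {false} _ = tt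
T-not⁻ {true}  h = h tt

infix 7 _≈ᵇ_ _==_

_≈ᵇ_ : Bool → Bool → Bool
b ≈ᵇ c = not (b xor c)

≈ᵇ⇒≡ : ∀ b c → T (b ≈ᵇ c) → b ≡ c
≈ᵇ⇒≡ false false _ = refl
≈ᵇ⇒≡ true  true  _ = refl

≈ᵇ-refl : ∀ b → T (b ≈ᵇ b)
≈ᵇ-refl false = tt
≈ᵇ-refl true  = tt

_==_ : ∀ {n} → Fin n → Fin n → Bool
i == j = does (i ≟ j)

==⇒≡ : ∀ {n} (i j : Fin n) → T (i == j) → i ≡ j
==⇒≡ i j t with i ≟ j
... | yes e = e

==-refl : ∀ {n} (i : Fin n) → (i == i) ≡ true
==-refl i with i ≟ i
... | yes _ = refl
... | no ne = contradiction refl ne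

≢⇒==-false : ∀ {n} {i j : Fin n} → i ≢ j → (i == j) ≡ false
≢⇒==-false {i = i} {j} ne with i ≟ j
... | yes e = contradiction e ne
... | no _  = refl

-- A constraint satisfaction problem: n variables take values in Fin k, and the label A i j of a pair
-- of variables restricts the pair of their values through ok.
assignable : ∀ {k} → (Fin k → Fin k → Bool → Bool) → ∀ n →
             (Fin n → Fin n → Bool) → (Fin n → Fin k → Bool) → Bool
assignable ok zero    A cand = true
assignable ok (suc n) A cand = anyF λ c → cand zero c ∧
  assignable ok n (λ i j → A (suc i) (suc j)) (λ j d → cand (suc j) d ∧ ok c d (A zero (suc j)))

record Assignment {k} (ok : Fin k → Fin k → Bool → Bool) (n : ℕ)
                  (A : Fin n → Fin n → Bool) (cand : Fin n → Fin k → Bool) : Set where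
  field
    val     : Fin n → Fin k
    allowed : ∀ i → T (cand i (val i))
    pairs   : ∀ i j → i Fin.< j → T (ok (val i) (val j) (A i j))
open Assignment

-- Choosing a value for the first variable prunes the candidates of all later ones (forward
-- checking), so candidacy in the reduced problem yields both the original candidacy and the pair
-- constraint with the first variable.
assignable-sound : ∀ {k} (ok : Fin k → Fin k → Bool → Bool) n A cand →
                   T (assignable ok n A cand) → Assignment ok n A cand
assignable-sound ok zero A cand t = record { val = λ () ; allowed = λ () ; pairs = λ () }
assignable-sound {k} ok (suc n) A cand t with anyF⁻ _ t
... | c , t′ with to T-∧ t′
...   | t₀ , t₁ = record { val = val′ ; allowed = allowed′ ; pairs = pairs′ }
  where
  rest = assignable-sound ok n _ _ t₁
  val′ : Fin (suc n) → Fin k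
  val′ zero    = c
  val′ (suc i) = val rest i
  allowed′ : ∀ i → T (cand i (val′ i))
  allowed′ zero    = t₀
  allowed′ (suc i) = proj₁ (to T-∧ (allowed rest i))
  pairs′ : ∀ i j → i Fin.< j → T (ok (val′ i) (val′ j) (A i j))
  pairs′ zero    (suc j) _         = proj₂ (to (T-∧ {cand (suc j) (val rest j)}) (allowed rest j))
  pairs′ (suc i) (suc j) (s≤s i<j) = pairs rest i j i<j

assignable-complete : ∀ {k} (ok : Fin k → Fin k → Bool → Bool) n A cand →
                      Assignment ok n A cand → T (assignable ok n A cand)
assignable-complete ok zero    A cand a = tt
assignable-complete ok (suc n) A cand a = anyF⁺ _ (val a zero) (from T-∧ (allowed a zero ,
  assignable-complete ok n _ _ record
    { val     = val a ∘ suc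
    ; allowed = λ j → from T-∧ (allowed a (suc j) , pairs a zero (suc j) (s≤s z≤n))
    ; pairs   = λ i j i<j → pairs a (suc i) (suc j) (s≤s i<j)
    }))

-- Adjacency tables and deciding induced embeddings.

Matrix : ℕ → Set
Matrix n = Vec (Vec Bool n) n

entry : ∀ {n} → Matrix n → Fin n → Fin n → Bool
entry M i j = lookup (lookup M i) j

matrix : ∀ {n} → (Fin n → Fin n → Bool) → Matrix n
matrix a = tabulate (λ i → tabulate (a i))

entry-matrix : ∀ {n} (a : Fin n → Fin n → Bool) i j → entry (matrix a) i j ≡ a i j
entry-matrix a i j = trans (cong (λ v → lookup v j) (lookup∘tabulate (λ i → tabulate (a i)) i))
                           (lookup∘tabulate (a i) j)

-- Under this constraint an assignment is an induced embedding: edges and non-edges both carry over,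
-- and distinct values give injectivity.
exactly : ∀ {m} → Matrix m → Fin m → Fin m → Bool → Bool
exactly N c d b = (b ≈ᵇ entry N c d) ∧ not (c == d)

embedsᴹ : ∀ {n m} → Matrix n → Matrix m → Bool
embedsᴹ {n} M N = assignable (exactly N) n (entry M) (λ _ _ → true)

embeds : Graph → Graph → Bool
embeds F G = embedsᴹ (matrix (adj F)) (matrix (adj G))

trichotomy : ∀ {n} (i j : Fin n) → i Fin.< j ⊎ i ≡ j ⊎ j Fin.< i
trichotomy zero    zero    = inj₂ (inj₁ refl)
trichotomy zero    (suc j) = inj₁ (s≤s z≤n)
trichotomy (suc i) zero    = inj₂ (inj₂ (s≤s z≤n))
trichotomy (suc i) (suc j) = Sum.map s≤s (Sum.map (cong suc) s≤s) (trichotomy i j)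

Realises : ∀ {n} → Matrix n → (H : Graph) → (Fin n → Fin (order H)) → Set
Realises M H f = Injective _≡_ _≡_ f × (∀ u v → entry M u v ≡ adj H (f u) (f v))

-- The assignment controls pairs `i < j` only; symmetry and irreflexivity of `F` and `H` supply the
-- others.
embedsᴹ-sound : ∀ F {n} (M : Matrix n) {H g} → Realises M H g →
                T (embedsᴹ (matrix (adj F)) M) → F ≺ H
embedsᴹ-sound F M {H} {g} (g-inj , g-adj) t = f , f-inj , f-adj
  where
  a = assignable-sound (exactly M) (order F) _ _ t
  f = g ∘ val a
  ok : ∀ i j → i Fin.< j → adj F i j ≡ adj H (f i) (f j) × f i ≢ f j
  ok i j i<j with to T-∧ (pairs a i j i<j)
  ... | t₁ , t₂ = trans (≡-sym (entry-matrix (adj F) i j)) (trans (≈ᵇ⇒≡ _ _ t₁) (g-adj _ _))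
                , λ e → T-not t₂ (from T-≡ (trans (cong (_== val a j) (g-inj e)) (==-refl (val a j))))
  f-inj : Injective _≡_ _≡_ f
  f-inj {i} {j} e with trichotomy i j
  ... | inj₁ i<j        = contradiction e (proj₂ (ok i j i<j))
  ... | inj₂ (inj₁ i≡j) = i≡j
  ... | inj₂ (inj₂ j<i) = contradiction (≡-sym e) (proj₂ (ok j i j<i))
  f-adj : ∀ i j → adj F i j ≡ adj H (f i) (f j)
  f-adj i j with trichotomy i j
  ... | inj₁ i<j         = proj₁ (ok i j i<j)
  ... | inj₂ (inj₁ refl) = trans (irrefl F i) (≡-sym (irrefl H (f i)))
  ... | inj₂ (inj₂ j<i)  = trans (sym F i j) (trans (proj₁ (ok j i j<i)) (sym H _ _))

embeds-sound : ∀ F G → T (embeds F G) → F ≺ G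
embeds-sound F G = embedsᴹ-sound F (matrix (adj G)) {G} {id} (id , entry-matrix (adj G))

<⇒≢ : ∀ {n} {i j : Fin n} → i Fin.< j → i ≢ j
<⇒≢ i<j refl = ℕₚ.<-irrefl refl i<j

embeds-complete : ∀ F G → F ≺ G → T (embeds F G)
embeds-complete F G (f , inj , f-adj) = assignable-complete _ (order F) _ _ record
  { val     = f
  ; allowed = λ _ → tt
  ; pairs   = λ i j i<j → from T-∧
      ( subst T (cong₂ _≈ᵇ_ (trans (≡-sym (f-adj i j)) (≡-sym (entry-matrix (adj F) i j)))
                            (≡-sym (entry-matrix (adj G) (f i) (f j))))
                (≈ᵇ-refl (adj G (f i) (f j)))
      , T-not⁻ (λ t → <⇒≢ i<j (inj (==⇒≡ _ _ t))))
  }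

_≺?_ : ∀ F G → Dec (F ≺ G)
F ≺? G = map′ (embeds-sound F G) (embeds-complete F G) (T? (embeds F G))

≺-trans : ∀ {A B C} → A ≺ B → B ≺ C → A ≺ C
≺-trans (f , f-inj , f-adj) (g , g-inj , g-adj) =
  g ∘ f , f-inj ∘ g-inj , λ u v → trans (f-adj u v) (g-adj (f u) (f v))

-- Exhaustive extension of connected graphs

-- Working with tables instead of `Graph` spares the search all proofs of symmetry and
-- irreflexivity.
extend : ∀ {n} → Vec Bool n → Matrix n → Matrix (suc n)
extend r M = (false ∷ r) ∷ Vec.zipWith _∷_ r M

allRows : ∀ n → (Vec Bool n → Bool) → Bool
allRows zero    p = p []
allRows (suc n) p = allRows n (λ r → p (true ∷ r)) ∧ allRows n (λ r → p (false ∷ r))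

allRows⁻ : ∀ n p → T (allRows n p) → ∀ r → T (p r)
allRows⁻ zero    p t []          = t
allRows⁻ (suc n) p t (true  ∷ r) = allRows⁻ n _ (proj₁ (to T-∧ t)) r
allRows⁻ (suc n) p t (false ∷ r) = allRows⁻ n _ (proj₂ (to (T-∧ {allRows n (λ r → p (true ∷ r))}) t)) r

matrices : List Graph → List (∃ Matrix)
matrices = map λ F → order F , matrix (adj F)

-- In the second alternative the orders agree, so the member of `S` fills the whole table.
expected : List (∃ Matrix) → List (∃ Matrix) → ∀ n → Matrix n → Bool
expected S 𝓕 n M = any (λ (_ , F) → embedsᴹ F M) 𝓕
                 ∨ any (λ (k , s) → (k ≡ᵇ n) ∧ embedsᴹ s M) S

-- Rows without a neighbour are passed over, because a connected graph can always be grown by a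
-- vertex adjacent to the part already found.
closedAt : List (∃ Matrix) → List (∃ Matrix) → ∀ n → Matrix n → Bool
closedAt S 𝓕 n M = allRows n λ r → not (anyF (lookup r)) ∨ expected S 𝓕 (suc n) (extend r M)

closedᴹ : List (∃ Matrix) → List (∃ Matrix) → Bool
closedᴹ S 𝓕 = all (λ (k , s) → closedAt S 𝓕 k s) S

closed : List Graph → List Graph → Bool
closed S 𝓕 = closedᴹ (matrices S) (matrices 𝓕)

entry-lookup : ∀ {n} (r : Vec Bool n) (M : Matrix n) i j →
               entry (extend r M) (suc i) (suc j) ≡ entry M i j
entry-lookup r M i j = cong (λ v → lookup v (suc j)) (lookup-zipWith _∷_ i r M)

entry-border : ∀ {n} (r : Vec Bool n) (M : Matrix n) i →
               entry (extend r M) (suc i) zero ≡ lookup r i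
entry-border r M i = cong (λ v → lookup v zero) (lookup-zipWith _∷_ i r M)

realises-matrix : ∀ s H (e : s ≺ H) → Realises (matrix (adj s)) H (proj₁ e)
realises-matrix s H (f , inj , f-adj) = inj , λ u v → trans (entry-matrix (adj s) u v) (f-adj u v)

realises-extend : ∀ {n} {M : Matrix n} {H f} w → Realises M H f → (∀ i → f i ≢ w) →
  ∃ λ g → Realises (extend (tabulate (λ i → adj H w (f i))) M) H g
realises-extend {n} {M} {H} {f} w (inj , f-adj) f≢w = g , g-inj , g-adj
  where
  r = tabulate (λ i → adj H w (f i))
  g : Fin (suc n) → Fin (order H)
  g zero    = w
  g (suc i) = f i
  g-inj : Injective _≡_ _≡_ g
  g-inj {zero}  {zero}  e = refl
  g-inj {zero}  {suc j} e = contradiction (≡-sym e) (f≢w j)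
  g-inj {suc i} {zero}  e = contradiction e (f≢w i)
  g-inj {suc i} {suc j} e = cong suc (inj e)
  g-adj : ∀ u v → entry (extend r M) u v ≡ adj H (g u) (g v)
  g-adj zero    zero    = ≡-sym (irrefl H w)
  g-adj zero    (suc j) = lookup∘tabulate _ j
  g-adj (suc i) zero    = trans (entry-border r M i) (trans (lookup∘tabulate _ i) (sym H w (f i)))
  g-adj (suc i) (suc j) = trans (entry-lookup r M i j) (f-adj i j)


≺-injective⇒≤ : ∀ {s H} → s ≺ H → order s ≤ order H
≺-injective⇒≤ (f , inj , _) = injective⇒≤ inj

≺-onto⇒≻ : ∀ {s H} (e : s ≺ H) → (∀ v → ∃ λ i → proj₁ e i ≡ v) → H ≺ s
≺-onto⇒≻ {s} {H} (f , inj , f-adj) onto = proj₁ ∘ onto , g-inj , g-adj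
  where
  g-inj : Injective _≡_ _≡_ (proj₁ ∘ onto)
  g-inj {u} {v} e = trans (≡-sym (proj₂ (onto u))) (trans (cong f e) (proj₂ (onto v)))
  g-adj : ∀ u v → adj H u v ≡ adj s (proj₁ (onto u)) (proj₁ (onto v))
  g-adj u v = trans (cong₂ (adj H) (≡-sym (proj₂ (onto u))) (≡-sym (proj₂ (onto v))))
                    (≡-sym (f-adj _ _))

inImage? : ∀ {m n} (f : Fin n → Fin m) v → Dec (∃ λ i → f i ≡ v)
inImage? f v = any? (λ i → f i ≟ v)

-- Follow the walk to the first edge that leaves the image.
leaves-image : ∀ {H : Graph} {n} (f : Fin n → Fin (order H)) {P u w} →
               (∃ λ i → f i ≡ u) → ¬ (∃ λ i → f i ≡ w) → WalkIn H P u w →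
               ∃ λ i → ∃ λ x → Adj H x (f i) × (∀ j → f j ≢ x)
leaves-image f i∈ w∉ (here _) = contradiction i∈ w∉
leaves-image {H} f (i , refl) w∉ (step {v = v} _ uv walk) with inImage? f v
... | yes v∈ = leaves-image f v∈ w∉ walk
... | no  v∉ = i , v , trans (sym H v (f i)) uv , λ j e → v∉ (j , e)

-- An induced copy of `s` inside `H` is grown. If it misses a vertex, connectedness gives an outside
-- vertex adjacent to the copy; by closure the enlarged copy contains a member of `𝓕`, which is
-- excluded, or a member of `S` of order one larger. The fuel bounds the number of vertices still
-- missing.
classify-from : ∀ S 𝓕 → T (closed S 𝓕) → ∀ H → Connected H → All (λ F → ¬ (F ≺ H)) 𝓕 →
                ∀ fuel {s} → s ∈ S → s ≺ H → Fin (order s) → order H ≤ order s + fuel → Any (H ≺_) S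
classify-from S 𝓕 cl H conn free fuel {s} s∈S s≺H i₀ bound
  with any? (λ v → ¬? (inImage? (proj₁ s≺H) v))
-- The copy covers `H`, so inverting it embeds `H` in `s`.
... | no full = Any.map (λ { refl → ≺-onto⇒≻ {s} {H} s≺H λ v →
        decidable-stable (inImage? (proj₁ s≺H) v) λ v∉ → full (v , v∉) }) s∈S
... | yes (v , v∉) = grow (leaves-image f (i₀ , refl) v∉ (conn (f i₀) v))
  where
  f = proj₁ s≺H
  grow : (∃ λ i → ∃ λ x → Adj H x (f i) × (∀ j → f j ≢ x)) → Any (H ≺_) S
  grow (i , x , xfi , x∉) = continue (to (T-∨ {not (anyF (lookup r))}) at-r)
    where
    r = tabulate (λ j → adj H x (f j))
    M = extend r (matrix (adj s))
    M-realised : ∃ λ g → Realises M H g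
    M-realised = realises-extend {H = H} x (realises-matrix s H s≺H) x∉
    at-s : T (closedAt (matrices S) (matrices 𝓕) (order s) (matrix (adj s)))
    at-s = All.lookup (All.map⁻ (all⁺ (λ (k , s) → closedAt (matrices S) (matrices 𝓕) k s) (matrices S) cl)) s∈S
    at-r : T (not (anyF (lookup r)) ∨ expected (matrices S) (matrices 𝓕) (suc (order s)) M)
    at-r = allRows⁻ (order s) _ at-s r
    conclude : Any (λ s′ → T ((order s′ ≡ᵇ suc (order s)) ∧ embedsᴹ (matrix (adj s′)) M)) S → Any (H ≺_) S
    conclude a with find a
    ... | s′ , s′∈S , t with to (T-∧ {order s′ ≡ᵇ suc (order s)}) t
    ...   | t₁ , t₂ = next fuel bound
      where
      s′≺H : s′ ≺ H
      s′≺H = embedsᴹ-sound s′ M {H} (proj₂ M-realised) t₂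
      s′≡ : order s′ ≡ suc (order s)
      s′≡ = ℕₚ.≡ᵇ⇒≡ _ _ t₁
      next : ∀ fuel → order H ≤ order s + fuel → Any (H ≺_) S
      -- Without fuel `H` has no more vertices than `s`, but `s′` has one more and embeds in `H`.
      next zero b = contradiction
        (ℕₚ.≤-trans (ℕₚ.≤-reflexive (≡-sym s′≡)) (ℕₚ.≤-trans (≺-injective⇒≤ {s′} {H} s′≺H)
          (ℕₚ.≤-trans b (ℕₚ.≤-reflexive (ℕₚ.+-identityʳ _)))))
        (ℕₚ.<-irrefl refl)
      next (suc k) b = classify-from S 𝓕 cl H conn free k s′∈S s′≺H (subst Fin (≡-sym s′≡) zero)
        (ℕₚ.≤-trans b (ℕₚ.≤-reflexive (trans (ℕₚ.+-suc _ k) (cong (_+ k) (≡-sym s′≡)))))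
    continue : T (not (anyF (lookup r))) ⊎ T (expected (matrices S) (matrices 𝓕) (suc (order s)) M) → Any (H ≺_) S
    continue (inj₁ t) = contradiction (anyF⁺ (lookup r) i (from T-≡ (trans (lookup∘tabulate _ i) xfi))) (T-not t)
    continue (inj₂ t) with to (T-∨ {any (λ (_ , F) → embedsᴹ F M) (matrices 𝓕)}) t
    ... | inj₁ tF with find (Any.map⁻ (any⁻ _ (matrices 𝓕) tF))
    ...   | F , F∈𝓕 , t′ = contradiction (embedsᴹ-sound F M {H} (proj₂ M-realised) t′) (All.lookup free F∈𝓕)
    continue (inj₂ t) | inj₂ tS = conclude (Any.map⁻ (any⁻ _ (matrices S) tS))

K₁ : Graph
K₁ = fromEdges 1 []

classify : ∀ S 𝓕 → closed (K₁ ∷ S) 𝓕 ≡ true → ∀ H → Connected H → 1 ≤ order H →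
           All (λ F → ¬ (F ≺ H)) 𝓕 → Any (H ≺_) (K₁ ∷ S)
classify S 𝓕 cl H conn 1≤ free =
  classify-from (K₁ ∷ S) 𝓕 (from T-≡ cl) H conn free (order H) (here refl) K₁≺H zero (ℕₚ.n≤1+n _)
  where
  v : Fin (order H)
  v = Fin.fromℕ< 1≤
  K₁≺H : K₁ ≺ H
  K₁≺H = (λ _ → v) , (λ { {zero} {zero} _ → refl }) , λ { zero zero → ≡-sym (irrefl H v) }

-- Cycles and classes of vertices

infixr 4 _++ʷ_

_++ʷ_ : ∀ {G P u v w} → WalkIn G P u v → WalkIn G P v w → WalkIn G P u w
here _      ++ʷ q = q
step p e ws ++ʷ q = step p e (ws ++ʷ q)

walk-end : ∀ {G P u v} → WalkIn G P u v → P v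
walk-end (here p)     = p
walk-end (step _ _ w) = walk-end w

reverseʷ : ∀ {G P u v} → WalkIn G P u v → WalkIn G P v u
reverseʷ (here p) = here p
reverseʷ {G} (step {u} {v} p e w) =
  reverseʷ w ++ʷ step (walk-end (reverseʷ w)) (trans (sym G v u) e) (here p)

_implies_ : Bool → Bool → Bool
b implies c = not b ∨ c

infixr 4 _implies_

implies⁻ : ∀ {b c} → T (b implies c) → T b → T c
implies⁻ {true} t _ = t

-- safe explores the closed walks from st that visit every class marked by single at most once (seen holds the
-- classes met so far) and checks that none of them visits all the other classes.
safe : ∀ {k} (C : Fin k → Fin k → Bool) (single : Fin k → Bool) → ℕ → (Fin k → Bool) → Fin k → Fin k → Bool
safe C single zero       seen cur st = false
safe C single (suc fuel) seen cur st =
  not ((cur == st ∨ C cur st) ∧ allF (λ c → single c ∨ seen c)) ∧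
  allF (λ c → C cur c ∧ not (single c ∧ seen c) implies safe C single fuel (λ d → d == c ∨ seen d) c st)

-- Induction along the cycle: `f` lists the classes of the vertices from the current one onwards,
-- and the search performed by `safe` contains this class sequence as one of its branches.
safe-sound : ∀ {k} (C : Fin k → Fin k → Bool) single st n (f : Fin (suc n) → Fin k) fuel seen →
  T (safe C single fuel seen (f zero) st) → T (seen (f zero)) →
  (∀ (i : Fin n) → f (inject₁ i) ≡ f (suc i) ⊎ T (C (f (inject₁ i)) (f (suc i)))) →
  (∀ i → T (single (f (suc i))) → ¬ T (seen (f (suc i)))) →
  (∀ i j → T (single (f i)) → f i ≡ f j → i ≡ j) →
  f (fromℕ n) ≡ st ⊎ T (C (f (fromℕ n)) st) →
  ¬ (∀ c → ¬ T (single c) → T (seen c) ⊎ ∃ λ i → f i ≡ c)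
safe-sound C single st zero f (suc fuel) seen s seen₀ steps fresh once closes all-seen =
  T-not (proj₁ (to T-∧ s)) (from T-∧ (closes′ closes , seen-all))
  where
  closes′ : f zero ≡ st ⊎ T (C (f zero) st) → T ((f zero == st) ∨ C (f zero) st)
  closes′ (inj₁ refl) = from T-∨ (inj₁ (from T-≡ (==-refl (f zero))))
  closes′ (inj₂ t)    = from T-∨ (inj₂ t)
  seen-all : T (allF (λ c → single c ∨ seen c))
  seen-all = allF⁺ _ λ c → seen-c c (single c) refl
    where
    seen-c : ∀ c b → single c ≡ b → T (single c ∨ seen c)
    seen-c c true  e = from T-∨ (inj₁ (from T-≡ e))
    seen-c c false e with all-seen c (λ t → subst T e t)
    ... | inj₁ t           = from T-∨ (inj₂ t)
    ... | inj₂ (zero , refl) = from T-∨ (inj₂ seen₀)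
safe-sound C single st (suc n) f (suc fuel) seen s seen₀ steps fresh once closes all-seen with steps zero
-- Staying within a class costs no fuel, so the bound does not depend on the sizes of the classes.
... | inj₁ e = safe-sound C single st n (f ∘ suc) (suc fuel) seen
      (subst (λ c → T (safe C single (suc fuel) seen c st)) e s)
      (subst (T ∘ seen) e seen₀) (steps ∘ suc) (fresh ∘ suc)
      (λ i j t q → suc-injective (once (suc i) (suc j) t q)) closes
      λ c ns → case all-seen c ns of λ
        { (inj₁ t) → inj₁ t
        ; (inj₂ (zero , refl)) → inj₁ seen₀
        ; (inj₂ (suc i , q)) → inj₂ (i , q) }
... | inj₂ t = safe-sound C single st n (f ∘ suc) fuel (λ d → d == f 1F ∨ seen d)
      (implies⁻ (allF⁻ _ (proj₂ (to T-∧ s)) (f 1F))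
        (from T-∧ (t , T-not⁻ (λ q → fresh zero (proj₁ (to T-∧ q)) (proj₂ (to (T-∧ {single (f 1F)}) q))))))
      (from T-∨ (inj₁ (from T-≡ (==-refl (f 1F)))))
      (steps ∘ suc)
      (λ i sg q → case to T-∨ q of λ
        { (inj₁ e) → contradiction (once (suc (suc i)) 1F sg (==⇒≡ _ _ e)) (λ ())
        ; (inj₂ q′) → fresh (suc i) sg q′ })
      (λ i j t q → suc-injective (once (suc i) (suc j) t q)) closes
      λ c ns → case all-seen c ns of λ
        { (inj₁ t) → inj₁ (from T-∨ (inj₂ t))
        ; (inj₂ (zero , refl)) → inj₁ (from (T-∨ {f zero == f 1F}) (inj₂ seen₀))
        ; (inj₂ (suc i , q)) → inj₂ (i , q) }

-- A `Cycle` may start anywhere, so every class is tried as the start.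
alwaysSafe : ∀ {k} (C : Fin k → Fin k → Bool) (single : Fin k → Bool) → ℕ → Bool
alwaysSafe C single fuel = allF λ c → safe C single fuel (_== c) c c

-- Each class not marked single contains an edge, so a dominating cycle would visit all these
-- classes, which `alwaysSafe` rules out.
no-dominating-cycle : ∀ {k} (C : Fin k → Fin k → Bool) single fuel →
  alwaysSafe C single fuel ≡ true → ∀ G (cls : Fin (order G) → Fin k) →
  (∀ u v → Adj G u v → cls u ≡ cls v ⊎ T (C (cls u) (cls v))) →
  (∀ u v → T (single (cls u)) → cls u ≡ cls v → u ≡ v) →
  (∀ c → ¬ T (single c) → ∃ λ u → ∃ λ v → Adj G u v × cls u ≡ c × cls v ≡ c) →
  ¬ HasDominatingCycle G
no-dominating-cycle C single fuel ok G cls h-adj h-single h-core (cyc , dom) =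
  safe-sound C single (f zero) _ f fuel (_== f zero)
    (allF⁻ _ (from T-≡ ok) (f zero)) (from T-≡ (==-refl (f zero)))
    (λ i → h-adj _ _ (consec cyc i))
    (λ i sg q → contradiction (once (suc i) zero sg (==⇒≡ _ _ q)) (λ ()))
    once (h-adj _ _ (closing cyc))
    λ c ns → inj₂ (met c (h-core c ns))
  where
  f : Fin _ → Fin _
  f = cls ∘ vtx cyc
  once : ∀ i j → T (single (f i)) → f i ≡ f j → i ≡ j
  once i j sg e = distinct cyc (h-single _ _ sg e)
  met : ∀ c → (∃ λ u → ∃ λ v → Adj G u v × cls u ≡ c × cls v ≡ c) → ∃ λ i → f i ≡ c
  met c (u , v , uv , u∈c , v∈c) with dom u v uv
  ... | inj₁ (i , e) = i , trans (cong cls e) u∈c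
  ... | inj₂ (i , e) = i , trans (cong cls e) v∈c

single< : ∀ {k} → ℕ → Fin k → Bool
single< s c = toℕ c ℕ.<ᵇ s

-- Classes 0-5 of prism and 0-1 of book are single vertices; a cycle must miss one of the remaining three.
prism book : Graph
prism = fromEdges 9 ((0 , 1) ∷ (0 , 2) ∷ (1 , 2) ∷ (3 , 4) ∷ (3 , 5) ∷ (4 , 5) ∷
  (0 , 3) ∷ (1 , 4) ∷ (2 , 5) ∷ (0 , 6) ∷ (3 , 6) ∷ (1 , 7) ∷ (4 , 7) ∷ (2 , 8) ∷ (5 , 8) ∷ [])
book = fromEdges 5 ((0 , 1) ∷ (0 , 2) ∷ (0 , 3) ∷ (0 , 4) ∷ (1 , 2) ∷ (1 , 3) ∷ (1 , 4) ∷ [])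

-- No two of the classes 6 to 8 are adjacent, so a walk makes at most thirteen visits: the six
-- single classes with seven others around and between them. Hence fuel 15 is enough.
prism-safe : alwaysSafe (adj prism) (single< 6) 15 ≡ true
prism-safe = refl

book-safe : alwaysSafe (adj book) (single< 2) 8 ≡ true
book-safe = refl

==-sym : ∀ {n} (i j : Fin n) → (i == j) ≡ (j == i)
==-sym i j with i ≟ j
... | yes refl = ≡-sym (==-refl i)
... | no  i≢j  = ≡-sym (≢⇒==-false (i≢j ∘ ≡-sym))

isSingle : ∀ s {t} → Fin (s + t) → Bool
isSingle s c = [ (λ _ → true) , (λ _ → false) ]′ (splitAt s c)

-- Blow-ups of patterns

-- s vertices occurring once, and m copies of each of t further ones.
Vertex : ℕ → ℕ → ℕ → Set
Vertex s t m = Fin s ⊎ (Fin t × Fin m)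

node : ∀ {s t m} → Vertex s t m → Fin (s + t)
node {s} {t} (inj₁ x)       = x ↑ˡ t
node {s} {t} (inj₂ (j , _)) = s ↑ʳ j

-- A template edge between two copied nodes joins only vertices of the same copy (`aligned`),
-- whereas a single node is joined to every copy. `clones` are different copies of one node.
aligned clones : ∀ {s t m} → Vertex s t m → Vertex s t m → Bool
aligned (inj₂ (_ , k)) (inj₂ (_ , l)) = k == l
aligned _              _              = true
clones (inj₂ (i , k)) (inj₂ (j , l)) = i == j ∧ not (k == l)
clones _              _              = false

aligned-sym : ∀ {s t m} (u v : Vertex s t m) → aligned u v ≡ aligned v u
aligned-sym (inj₁ _) (inj₁ _) = refl
aligned-sym (inj₁ _) (inj₂ _) = refl
aligned-sym (inj₂ _) (inj₁ _) = refl
aligned-sym (inj₂ (_ , k)) (inj₂ (_ , l)) = ==-sym k l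

clones-sym : ∀ {s t m} (u v : Vertex s t m) → clones u v ≡ clones v u
clones-sym (inj₁ _) (inj₁ _) = refl
clones-sym (inj₁ _) (inj₂ _) = refl
clones-sym (inj₂ _) (inj₁ _) = refl
clones-sym (inj₂ (i , k)) (inj₂ (j , l)) = cong₂ (λ a b → a ∧ not b) (==-sym i j) (==-sym k l)

clones-irrefl : ∀ {s t m} (u : Vertex s t m) → clones u u ≡ false
clones-irrefl (inj₁ _) = refl
clones-irrefl (inj₂ (i , k)) = trans (cong (λ b → i == i ∧ not b) (==-refl k)) (∧-zeroʳ (i == i))

encode : ∀ s t m → Vertex s t m → Fin (s + t * m)
encode s t m = join s (t * m) ∘ Sum.map₂ (uncurry combine)

decode : ∀ s t m → Fin (s + t * m) → Vertex s t m
decode s t m = Sum.map₂ (remQuot {t} m) ∘ splitAt s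

decode-encode : ∀ s t m u → decode s t m (encode s t m u) ≡ u
decode-encode s t m (inj₁ x) = cong (Sum.map₂ (remQuot {t} m)) (splitAt-↑ˡ s x (t * m))
decode-encode s t m (inj₂ (j , k)) =
  trans (cong (Sum.map₂ (remQuot {t} m)) (splitAt-↑ʳ s (t * m) (combine j k))) (cong inj₂ (remQuot-combine j k))

encode-decode : ∀ s t m i → encode s t m (decode s t m i) ≡ i
encode-decode s t m i = trans (cong (join s (t * m)) (lemma (splitAt s i))) (join-splitAt s (t * m) i)
  where
  lemma : ∀ x → Sum.map₂ (uncurry combine) (Sum.map₂ (remQuot {t} m) x) ≡ x
  lemma (inj₁ x) = refl
  lemma (inj₂ y) = cong inj₂ (combine-remQuot {t} m y)

decode-injective : ∀ s t m {i j} → decode s t m i ≡ decode s t m j → i ≡ j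
decode-injective s t m {i} {j} e =
  trans (≡-sym (encode-decode s t m i)) (trans (cong (encode s t m) e) (encode-decode s t m j))

encode-injective : ∀ s t m {u v} → encode s t m u ≡ encode s t m v → u ≡ v
encode-injective s t m {u} {v} e =
  trans (≡-sym (decode-encode s t m u)) (trans (cong (decode s t m) e) (decode-encode s t m v))

-- Nodes below `singles` occur once in a blow-up, the following `copied` ones `m` times; `clique`
-- decides whether the copies of a node form a clique or an independent set.
record Pattern : Set where
  field
    singles copied : ℕ
    edges          : List (ℕ × ℕ)
    clique         : Bool

open Pattern

Node : Pattern → Set
Node 𝒫 = Fin (singles 𝒫 + copied 𝒫)

template : Pattern → Graph
template 𝒫 = fromEdges (singles 𝒫 + copied 𝒫) (edges 𝒫)

linked : ∀ 𝒫 {m} → Vertex (singles 𝒫) (copied 𝒫) m → Vertex (singles 𝒫) (copied 𝒫) m → Bool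
linked 𝒫 u v = adj (template 𝒫) (node u) (node v) ∧ aligned u v ∨ clique 𝒫 ∧ clones u v

blowup : Pattern → ℕ → Graph
blowup 𝒫 m = record
  { order  = singles 𝒫 + copied 𝒫 * m
  ; adj    = λ u v → linked 𝒫 (dec u) (dec v)
  ; sym    = λ u v → linked-sym (dec u) (dec v)
  ; irrefl = λ u → linked-irrefl (dec u)
  }
  where
  dec = decode (singles 𝒫) (copied 𝒫) m
  linked-sym : ∀ u v → linked 𝒫 {m} u v ≡ linked 𝒫 v u
  linked-sym u v = cong₂ _∨_ (cong₂ _∧_ (sym (template 𝒫) (node u) (node v)) (aligned-sym u v))
                             (cong (clique 𝒫 ∧_) (clones-sym u v))
  linked-irrefl : ∀ u → linked 𝒫 {m} u u ≡ false
  linked-irrefl u = cong₂ _∨_ (cong (_∧ aligned u u) (irrefl (template 𝒫) (node u)))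
                              (trans (cong (clique 𝒫 ∧_) (clones-irrefl u)) (∧-zeroʳ (clique 𝒫)))

single-node : ∀ s {t m} (u : Vertex s t m) → T (isSingle s (node u)) → ∃ λ x → u ≡ inj₁ x
single-node s (inj₁ x) _ = x , refl
single-node s {t} (inj₂ (j , k)) q with splitAt s (s ↑ʳ j) | splitAt-↑ʳ s t j
... | .(inj₂ j) | refl = ⊥-elim q

node-injective : ∀ s {t m} (u v : Vertex s t m) → T (isSingle s (node u)) → node u ≡ node v → u ≡ v
node-injective s {t} u v q e with single-node s u q | single-node s v (subst (T ∘ isSingle s) e q)
... | x , refl | y , refl = cong inj₁ (↑ˡ-injective t x y e)

aligned-single : ∀ s {t m} (u v : Vertex s t m) → T (isSingle s (node u) ∨ isSingle s (node v)) → T (aligned u v)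
aligned-single s (inj₁ _) _        _ = tt
aligned-single s (inj₂ _) (inj₁ _) _ = tt
aligned-single s u@(inj₂ _) v@(inj₂ _) q with to (T-∨ {isSingle s (node u)}) q
... | inj₁ q₁ = case single-node s u q₁ of λ { (_ , ()) }
... | inj₂ q₂ = case single-node s v q₂ of λ { (_ , ()) }

clones-node : ∀ {s t m} (u v : Vertex s t m) → T (clones u v) → node u ≡ node v
clones-node {s} (inj₂ (i , k)) (inj₂ (j , l)) q = cong (s ↑ʳ_) (==⇒≡ i j (proj₁ (to T-∧ q)))

node-clones : ∀ s {t m} (u v : Vertex s t m) → u ≢ v → node u ≡ node v → T (clones u v)
node-clones s {t} u@(inj₁ x) v u≢v e = contradiction (node-injective s u v single e) u≢v
  where
  single : T (isSingle s (x ↑ˡ t))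
  single rewrite splitAt-↑ˡ s x t = tt
node-clones s {t} u v@(inj₁ x) u≢v e = contradiction (≡-sym (node-injective s v u single (≡-sym e))) u≢v
  where
  single : T (isSingle s (x ↑ˡ t))
  single rewrite splitAt-↑ˡ s x t = tt
node-clones s (inj₂ (i , k)) (inj₂ (j , l)) u≢v e with ↑ʳ-injective s i j e
... | refl = from T-∧ (from T-≡ (==-refl i) , T-not⁻ λ q → u≢v (cong (λ k → inj₂ (i , k)) (==⇒≡ k l q)))

-- What the nodes of two distinct vertices of a blow-up say about their adjacency.
typing : ∀ 𝒫 → Node 𝒫 → Node 𝒫 → Bool → Bool
typing 𝒫 c d true  = adj (template 𝒫) c d ∨ clique 𝒫 ∧ c == d ∧ not (isSingle (singles 𝒫) c)
typing 𝒫 c d false =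
  not (adj (template 𝒫) c d ∧ (isSingle (singles 𝒫) c ∨ isSingle (singles 𝒫) d)) ∧
  not (c == d ∧ (clique 𝒫 ∨ isSingle (singles 𝒫) c))

typing-sound : ∀ 𝒫 {m} (u v : Vertex (singles 𝒫) (copied 𝒫) m) → u ≢ v →
               T (typing 𝒫 (node u) (node v) (linked 𝒫 u v))
typing-sound 𝒫 u v u≢v with linked 𝒫 u v in eq
... | true = case to (T-∨ {a ∧ aligned u v}) (from T-≡ eq) of λ
  { (inj₁ q) → from (T-∨ {a}) (inj₁ (proj₁ (to (T-∧ {a}) q)))
  ; (inj₂ q) →
      let cl , cs = to (T-∧ {clique 𝒫}) q
          e       = clones-node u v cs
      in from (T-∨ {a}) (inj₂ (from (T-∧ {clique 𝒫}) (cl , from (T-∧ {node u == node v})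
           ( subst (λ c → T (node u == c)) e (from T-≡ (==-refl (node u)))
           , T-not⁻ λ sg → u≢v (node-injective (singles 𝒫) u v sg e))))) }
  where a = adj (template 𝒫) (node u) (node v)
... | false = from T-∧
  ( T-not⁻ (λ q → let l , sg = to (T-∧ {a}) q in
      unlinked (from (T-∨ {a ∧ aligned u v}) (inj₁ (from (T-∧ {a}) (l , aligned-single (singles 𝒫) u v sg)))))
  , T-not⁻ (λ q → let e , r = to (T-∧ {node u == node v}) q in case to (T-∨ {clique 𝒫}) r of λ
      { (inj₁ cl) → unlinked (from (T-∨ {a ∧ aligned u v})
                      (inj₂ (from (T-∧ {clique 𝒫}) (cl , node-clones (singles 𝒫) u v u≢v (==⇒≡ _ _ e)))))
      ; (inj₂ sg) → u≢v (node-injective (singles 𝒫) u v sg (==⇒≡ _ _ e)) }))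
  where
  a = adj (template 𝒫) (node u) (node v)
  unlinked : ¬ T (linked 𝒫 u v)
  unlinked q = subst T eq q

untypable : ∀ {k} (ok : Fin k → Fin k → Bool → Bool) G (τ : Fin (order G) → Fin k) →
            (∀ u v → u ≢ v → T (ok (τ u) (τ v) (adj G u v))) →
            ∀ F cand → assignable ok (order F) (adj F) cand ≡ false →
            ∀ (e : F ≺ G) → (∀ i → T (cand i (τ (proj₁ e i)))) → ⊥
untypable ok G τ typed F cand none (f , inj , f-adj) allow =
  subst T none (assignable-complete ok (order F) (adj F) cand record
    { val     = τ ∘ f
    ; allowed = allow
    ; pairs   = λ i j i<j → subst (T ∘ ok (τ (f i)) (τ (f j))) (≡-sym (f-adj i j))
                  (typed (f i) (f j) (λ e → <⇒≢ i<j (inj e)))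
    })

excludes : Pattern → Graph → Bool
excludes 𝒫 F = not (assignable (typing 𝒫) (order F) (adj F) (λ _ _ → true))

-- The test sees only nodes and no copy indices, so one finite search settles all `m`.
excludes-sound : ∀ 𝒫 F → T (excludes 𝒫 F) → ∀ m → ¬ (F ≺ blowup 𝒫 m)
excludes-sound 𝒫 F q m e = untypable (typing 𝒫) (blowup 𝒫 m) (node ∘ dec)
  (λ u v u≢v → typing-sound 𝒫 (dec u) (dec v) (u≢v ∘ decode-injective (singles 𝒫) (copied 𝒫) m)) F (λ _ _ → true)
  (to T-not-≡ q) e (λ _ → tt)
  where dec = decode (singles 𝒫) (copied 𝒫) m

-- The node `c` in the copy `k` of the template; single nodes belong to every copy.
lift : ∀ 𝒫 {m} → Fin m → Node 𝒫 → Vertex (singles 𝒫) (copied 𝒫) m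
lift 𝒫 k c = Sum.map₂ (_, k) (splitAt (singles 𝒫) c)

node-lift : ∀ 𝒫 {m} (k : Fin m) c → node (lift 𝒫 k c) ≡ c
node-lift 𝒫 k c with splitAt (singles 𝒫) c | join-splitAt (singles 𝒫) (copied 𝒫) c
... | inj₁ x | e = e
... | inj₂ j | e = e

aligned-lift : ∀ 𝒫 {m} (k : Fin m) c d → T (aligned (lift 𝒫 k c) (lift 𝒫 k d))
aligned-lift 𝒫 k c d with splitAt (singles 𝒫) c | splitAt (singles 𝒫) d
... | inj₁ _ | inj₁ _ = tt
... | inj₁ _ | inj₂ _ = tt
... | inj₂ _ | inj₁ _ = tt
... | inj₂ _ | inj₂ _ = from T-≡ (==-refl k)

vertex : ∀ 𝒫 m → Vertex (singles 𝒫) (copied 𝒫) m → Fin (order (blowup 𝒫 m))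
vertex 𝒫 = encode (singles 𝒫) (copied 𝒫)

linked⇒Adj : ∀ 𝒫 {m} u v → T (linked 𝒫 u v) → Adj (blowup 𝒫 m) (vertex 𝒫 m u) (vertex 𝒫 m v)
linked⇒Adj 𝒫 {m} u v q = trans (cong₂ (linked 𝒫) (decode-encode _ _ m u) (decode-encode _ _ m v)) (to T-≡ q)

aligned⇒Adj : ∀ 𝒫 {m} u v → T (adj (template 𝒫) (node u) (node v)) → T (aligned u v) →
              Adj (blowup 𝒫 m) (vertex 𝒫 m u) (vertex 𝒫 m v)
aligned⇒Adj 𝒫 u v q a =
  linked⇒Adj 𝒫 u v (from (T-∨ {e ∧ aligned u v}) (inj₁ (from (T-∧ {e}) (q , a))))
  where e = adj (template 𝒫) (node u) (node v)

lift⇒Adj : ∀ 𝒫 {m} (k : Fin m) c d → T (adj (template 𝒫) c d) →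
           Adj (blowup 𝒫 m) (vertex 𝒫 m (lift 𝒫 k c)) (vertex 𝒫 m (lift 𝒫 k d))
lift⇒Adj 𝒫 k c d q = aligned⇒Adj 𝒫 (lift 𝒫 k c) (lift 𝒫 k d)
  (subst₂ (λ a b → T (adj (template 𝒫) a b)) (≡-sym (node-lift 𝒫 k c)) (≡-sym (node-lift 𝒫 k d)) q)
  (aligned-lift 𝒫 k c d)

-- Connectivity of blow-ups.

reach : ∀ {n} → (Fin n → Fin n → Bool) → (Fin n → Bool) → ℕ → Fin n → Fin n → Bool
reach a ok zero       u v = u == v
reach a ok (suc fuel) u v = u == v ∨ anyF λ w → a u w ∧ ok w ∧ reach a ok fuel w v

reach-sound : ∀ {n} (a : Fin n → Fin n → Bool) ok G P (φ : Fin n → Fin (order G)) →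
  (∀ c d → T (a c d) → Adj G (φ c) (φ d)) → (∀ c → T (ok c) → P (φ c)) →
  ∀ fuel c d → T (ok c) → T (reach a ok fuel c d) → WalkIn G P (φ c) (φ d)
reach-sound a ok G P φ φ-adj φ-ok zero c d okc r with ==⇒≡ c d r
... | refl = here (φ-ok c okc)
reach-sound a ok G P φ φ-adj φ-ok (suc fuel) c d okc r with to (T-∨ {c == d}) r
... | inj₁ e with ==⇒≡ c d e
...   | refl = here (φ-ok c okc)
reach-sound a ok G P φ φ-adj φ-ok (suc fuel) c d okc r | inj₂ q with anyF⁻ _ q
... | w , qw with to (T-∧ {a c w}) qw
...   | cw , q′ with to (T-∧ {ok w}) q′
...     | okw , rw = step (φ-ok c okc) (φ-adj c w cw) (reach-sound a ok G P φ φ-adj φ-ok fuel w d okw rw)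

-- The second condition leads every vertex of a blow-up to a vertex common to all copies of the template.
robust : ∀ 𝒫 → (Node 𝒫 → Bool) → Bool
robust 𝒫 ok =
  allF (λ c → allF λ d → ok c ∧ ok d implies reach (adj (template 𝒫)) ok 6 c d) ∧
  allF (λ j → anyF λ x → adj (template 𝒫) (singles 𝒫 ↑ʳ j) (x ↑ˡ copied 𝒫) ∧ ok (x ↑ˡ copied 𝒫))

-- Copy `k` is the meeting place: a single vertex already lies in it, any other vertex has a
-- permitted single neighbour, and within the copy the template check provides the walk.
robust-sound : ∀ 𝒫 ok → T (robust 𝒫 ok) → ∀ {m} (k : Fin m) (P : Fin (order (blowup 𝒫 m)) → Set) →
  (∀ c → T (ok c) → P (vertex 𝒫 m (lift 𝒫 k c))) →
  (∀ x → P (vertex 𝒫 m (inj₁ x)) → T (ok (x ↑ˡ copied 𝒫))) →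
  ∀ u v → P u → P v → WalkIn (blowup 𝒫 m) P u v
robust-sound 𝒫 ok r {m} k P ok⇒P P⇒ok u v Pu Pv = joined (anchor u Pu) (anchor v Pv)
  where
  s = singles 𝒫
  t = copied 𝒫
  Anchored : Fin (order (blowup 𝒫 m)) → Set
  Anchored w = ∃ λ c → T (ok c) × WalkIn (blowup 𝒫 m) P w (vertex 𝒫 m (lift 𝒫 k c))
  r₁ : T (allF λ c → allF λ d → ok c ∧ ok d implies reach (adj (template 𝒫)) ok 6 c d)
  r₁ = proj₁ (to (T-∧ {allF λ c → allF λ d → ok c ∧ ok d implies reach (adj (template 𝒫)) ok 6 c d}) r)
  r₂ : T (allF λ j → anyF λ x → adj (template 𝒫) (s ↑ʳ j) (x ↑ˡ t) ∧ ok (x ↑ˡ t))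
  r₂ = proj₂ (to (T-∧ {allF λ c → allF λ d → ok c ∧ ok d implies reach (adj (template 𝒫)) ok 6 c d}) r)
  lift-↑ˡ : ∀ x → lift 𝒫 {m} k (x ↑ˡ t) ≡ inj₁ x
  lift-↑ˡ x rewrite splitAt-↑ˡ s x t = refl
  anchor′ : ∀ (w : Vertex s t m) → P (vertex 𝒫 m w) → Anchored (vertex 𝒫 m w)
  anchor′ (inj₁ x) Pw = x ↑ˡ t , P⇒ok x Pw ,
    subst (λ y → WalkIn (blowup 𝒫 m) P (vertex 𝒫 m (inj₁ x)) (vertex 𝒫 m y)) (≡-sym (lift-↑ˡ x)) (here Pw)
  anchor′ (inj₂ (j , l)) Pw with anyF⁻ _ (allF⁻ _ r₂ j)
  ... | x , q with to (T-∧ {adj (template 𝒫) (s ↑ʳ j) (x ↑ˡ t)}) q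
  ...   | jx , okx = x ↑ˡ t , okx ,
    subst (λ y → WalkIn (blowup 𝒫 m) P (vertex 𝒫 m (inj₂ (j , l))) (vertex 𝒫 m y)) (≡-sym (lift-↑ˡ x))
      (step Pw (aligned⇒Adj 𝒫 (inj₂ (j , l)) (inj₁ x) jx tt)
        (here (subst (P ∘ vertex 𝒫 m) (lift-↑ˡ x) (ok⇒P _ okx))))
  anchor : ∀ w → P w → Anchored w
  anchor w Pw = subst Anchored (encode-decode s t m w)
    (anchor′ (decode s t m w) (subst P (≡-sym (encode-decode s t m w)) Pw))
  joined : Anchored u → Anchored v → WalkIn (blowup 𝒫 m) P u v
  joined (c , okc , walk-u) (d , okd , walk-v) = walk-u ++ʷ
    reach-sound (adj (template 𝒫)) ok (blowup 𝒫 m) P (vertex 𝒫 m ∘ lift 𝒫 k) (lift⇒Adj 𝒫 k) ok⇒P 6 c d okc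
      (implies⁻ (allF⁻ _ (allF⁻ _ r₁ c) d) (from (T-∧ {ok c}) (okc , okd))) ++ʷ
    reverseʷ walk-v

twoConnected : Pattern → Bool
twoConnected 𝒫 =
  (3 ℕ.≤ᵇ singles 𝒫 + copied 𝒫) ∧ robust 𝒫 (λ _ → true) ∧
  allF λ x → robust 𝒫 (λ c → not (c == (x ↑ˡ copied 𝒫)))

other : ∀ {m} (k : Fin (2 + m)) → ∃ λ l → l ≢ k
other zero    = 1F , λ ()
other (suc k) = 0F , λ ()

-- Deleting a single vertex affects every copy and is checked on the template. Deleting a copied
-- vertex leaves some other copy intact, which is why at least two copies are required.
twoConnected-sound : ∀ 𝒫 → T (twoConnected 𝒫) → ∀ m → TwoConnected (blowup 𝒫 (2 + m))
twoConnected-sound 𝒫 q m = size , connected , deleted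
  where
  s = singles 𝒫
  t = copied 𝒫
  G = blowup 𝒫 (2 + m)
  q₁ : T (3 ℕ.≤ᵇ s + t)
  q₁ = proj₁ (to (T-∧ {3 ℕ.≤ᵇ s + t}) q)
  q₂ : T (robust 𝒫 (λ _ → true))
  q₂ = proj₁ (to (T-∧ {robust 𝒫 (λ _ → true)}) (proj₂ (to (T-∧ {3 ℕ.≤ᵇ s + t}) q)))
  q₃ : T (allF λ x → robust 𝒫 (λ c → not (c == (x ↑ˡ copied 𝒫))))
  q₃ = proj₂ (to (T-∧ {robust 𝒫 (λ _ → true)}) (proj₂ (to (T-∧ {3 ℕ.≤ᵇ s + t}) q)))
  size : 3 ≤ s + t * (2 + m)
  size = ℕₚ.≤-trans (ℕₚ.≤ᵇ⇒≤ 3 _ q₁) (ℕₚ.+-monoʳ-≤ s (ℕₚ.m≤m*n t (2 + m)))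
  connected : Connected G
  connected u v = robust-sound 𝒫 (λ _ → true) q₂ {2 + m} 0F (λ _ → ⊤) _ _ u v tt tt
  deleted′ : ∀ z u v → u ≢ vertex 𝒫 (2 + m) z → v ≢ vertex 𝒫 (2 + m) z → WalkIn G (_≢ vertex 𝒫 (2 + m) z) u v
  deleted′ z@(inj₁ x) = robust-sound 𝒫 (λ c → not (c == (x ↑ˡ t))) (allF⁻ _ q₃ x) 0F (_≢ vertex 𝒫 (2 + m) z)
    (λ c ok e → T-not ok (subst (λ d → T (c == d))
      (trans (≡-sym (node-lift 𝒫 0F c)) (cong node (encode-injective s t (2 + m) {lift 𝒫 0F c} {z} e)))
      (from T-≡ (==-refl c))))
    (λ y y≢x → T-not⁻ λ e → y≢x (cong (vertex 𝒫 (2 + m) ∘ inj₁) (↑ˡ-injective t y x (==⇒≡ _ _ e))))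
  deleted′ z@(inj₂ (j , l)) = robust-sound 𝒫 (λ _ → true) q₂ (proj₁ (other l)) (_≢ vertex 𝒫 (2 + m) z)
    (λ c _ e → avoid c (encode-injective s t (2 + m) {lift 𝒫 (proj₁ (other l)) c} {z} e)) _
    where
    avoid : ∀ c → lift 𝒫 (proj₁ (other l)) c ≢ z
    avoid c e with splitAt s c
    avoid c e | inj₂ _ = proj₂ (other l) (cong proj₂ (inj₂-injective e))
  deleted : ∀ z u v → u ≢ z → v ≢ z → WalkIn G (_≢ z) u v
  deleted z = subst (λ z → ∀ u v → u ≢ z → v ≢ z → WalkIn G (_≢ z) u v)
                    (encode-decode s t (2 + m) z) (deleted′ (decode s t (2 + m) z))

-- `ρ` folds the template onto the class graph `C`, whose first `k` classes are to be single
-- vertices. Edges must stay in a class or follow an edge of `C`, and each further class must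
-- contain an edge, coming from a clique of copies or from the template.
compatible realised cyclic : ∀ 𝒫 (C : Graph) → ℕ → (Node 𝒫 → Fin (order C)) → Bool
compatible 𝒫 C k ρ = allF λ c → allF λ d →
    (adj (template 𝒫) c d implies (ρ c == ρ d ∨ adj C (ρ c) (ρ d))) ∧
    (ρ c == ρ d ∧ single< k (ρ c) implies c == d ∧ isSingle (singles 𝒫) c)
realised 𝒫 C k ρ = allF λ e → single< k e ∨
    (anyF λ c → ρ c == e ∧ (clique 𝒫 ∧ not (isSingle (singles 𝒫) c) ∨
      anyF λ d → ρ d == e ∧ adj (template 𝒫) c d))
cyclic 𝒫 C k ρ = compatible 𝒫 C k ρ ∧ realised 𝒫 C k ρ

cyclic-sound : ∀ 𝒫 C k fuel → alwaysSafe (adj C) (single< k) fuel ≡ true → ∀ ρ → T (cyclic 𝒫 C k ρ) →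
               ∀ m → ¬ HasDominatingCycle (blowup 𝒫 (2 + m))
cyclic-sound 𝒫 C k fuel sf ρ q m =
  no-dominating-cycle (adj C) (single< k) fuel sf G cls h-adj h-single h-core
  where
  s = singles 𝒫
  t = copied 𝒫
  G = blowup 𝒫 (2 + m)
  a = adj (template 𝒫)
  dec = decode s t (2 + m)
  q₁ : ∀ c d → T ((a c d implies (ρ c == ρ d ∨ adj C (ρ c) (ρ d))) ∧
                  (ρ c == ρ d ∧ single< k (ρ c) implies c == d ∧ isSingle s c))
  q₁ c = allF⁻ _ (allF⁻ _ (proj₁ (to (T-∧ {compatible 𝒫 C k ρ}) q)) c)
  cls : Fin (order G) → Fin (order C)
  cls = ρ ∘ node ∘ dec
  h-adj : ∀ u v → Adj G u v → cls u ≡ cls v ⊎ T (adj C (cls u) (cls v))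
  h-adj u v uv = linked-classes (dec u) (dec v) (from T-≡ uv)
    where
    linked-classes : ∀ u v → T (linked 𝒫 u v) → ρ (node u) ≡ ρ (node v) ⊎ T (adj C (ρ (node u)) (ρ (node v)))
    linked-classes u v l with to (T-∨ {a (node u) (node v) ∧ aligned u v}) l
    ... | inj₁ l₁ = Sum.map₁ (==⇒≡ _ _) (to (T-∨ {ρ (node u) == ρ (node v)})
          (implies⁻ (proj₁ (to (T-∧ {a nu nv implies (ρ nu == ρ nv ∨ adj C (ρ nu) (ρ nv))}) (q₁ nu nv)))
                    (proj₁ (to (T-∧ {a nu nv}) l₁))))
      where
      nu = node u
      nv = node v
    ... | inj₂ l₂ = inj₁ (cong ρ (clones-node u v (proj₂ (to (T-∧ {clique 𝒫}) l₂))))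
  h-single : ∀ u v → T (single< k (cls u)) → cls u ≡ cls v → u ≡ v
  h-single u v sg e = decode-injective s t (2 + m)
    (node-injective s (dec u) (dec v) (proj₂ (to (T-∧ {nu == nv}) r)) (==⇒≡ nu nv (proj₁ (to (T-∧ {nu == nv}) r))))
    where
    nu = node (dec u)
    nv = node (dec v)
    r : T (nu == nv ∧ isSingle s nu)
    r = implies⁻ (proj₂ (to (T-∧ {a nu nv implies (ρ nu == ρ nv ∨ adj C (ρ nu) (ρ nv))}) (q₁ nu nv)))
                 (from (T-∧ {ρ nu == ρ nv}) (subst (λ c → T (ρ nu == c)) e (from T-≡ (==-refl (ρ nu))) , sg))
  cls-lift : ∀ {e} l c → T (ρ c == e) → cls (vertex 𝒫 (2 + m) (lift 𝒫 l c)) ≡ e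
  cls-lift l c r = trans (cong (ρ ∘ node) (decode-encode s t (2 + m) (lift 𝒫 l c)))
                         (trans (cong ρ (node-lift 𝒫 l c)) (==⇒≡ _ _ r))
  clones-lift : ∀ c → T (not (isSingle s c)) → T (clones (lift 𝒫 {2 + m} 0F c) (lift 𝒫 1F c))
  clones-lift c ns with splitAt s c
  ... | inj₂ j = from (T-∧ {j == j}) (from T-≡ (==-refl j) , tt)
  linked-clones : ∀ c → T (clique 𝒫 ∧ not (isSingle s c)) → T (linked 𝒫 (lift 𝒫 {2 + m} 0F c) (lift 𝒫 1F c))
  linked-clones c cl with to (T-∧ {clique 𝒫}) cl
  ... | cl₁ , ns = from (T-∨ {a (node (lift 𝒫 {2 + m} 0F c)) (node (lift 𝒫 {2 + m} 1F c)) ∧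
                               aligned (lift 𝒫 {2 + m} 0F c) (lift 𝒫 1F c)})
                        (inj₂ (from (T-∧ {clique 𝒫}) (cl₁ , clones-lift c ns)))
  h-core : ∀ e → ¬ T (single< k e) → ∃ λ u → ∃ λ v → Adj G u v × cls u ≡ e × cls v ≡ e
  h-core e ns with to (T-∨ {single< k e}) (allF⁻ _ (proj₂ (to (T-∧ {compatible 𝒫 C k ρ}) q)) e)
  ... | inj₁ sg = contradiction sg ns
  ... | inj₂ r with anyF⁻ _ r
  ...   | c , rc with to (T-∧ {ρ c == e}) rc
  ...     | ρc , rd with to (T-∨ {clique 𝒫 ∧ not (isSingle s c)}) rd
  -- Two copies of one node form the required edge, hence `2 + m`.
  ...       | inj₁ cl = _ , _ , linked⇒Adj 𝒫 (lift 𝒫 0F c) (lift 𝒫 1F c) (linked-clones c cl)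
                      , cls-lift 0F c ρc , cls-lift 1F c ρc
  ...       | inj₂ rd′ with anyF⁻ _ rd′
  ...         | d , q′ = _ , _ , lift⇒Adj 𝒫 0F c d (proj₂ (to (T-∧ {ρ d == e}) q′))
                      , cls-lift 0F c ρc , cls-lift 0F d (proj₁ (to (T-∧ {ρ d == e}) q′))

-- Ladders

-- Three paths with levels 0 … L, with the graph with edges es on the three vertices of either extreme level.
ends : List (ℕ × ℕ) → Graph
ends = fromEdges 3

consecutive : ℕ → ℕ → Bool
consecutive p q = (suc p ≡ᵇ q) ∨ (suc q ≡ᵇ p)

extreme : ℕ → ℕ → ℕ → Bool
extreme L p q = (p ≡ᵇ 0) ∧ (q ≡ᵇ 0) ∨ (p ≡ᵇ L) ∧ (q ≡ᵇ L)

ladderAdj : List (ℕ × ℕ) → ℕ → Fin 3 × ℕ → Fin 3 × ℕ → Bool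
ladderAdj es L (i , p) (j , q) = i == j ∧ consecutive p q ∨ extreme L p q ∧ adj (ends es) i j

place : ∀ L → Fin (3 * suc L) → Fin 3 × ℕ
place L u = map₂ toℕ (remQuot {3} (suc L) u)

suc≡ᵇ : ∀ p → (suc p ≡ᵇ p) ≡ false
suc≡ᵇ zero    = refl
suc≡ᵇ (suc p) = suc≡ᵇ p

ladder : List (ℕ × ℕ) → ℕ → Graph
ladder es L = record
  { order  = 3 * suc L
  ; adj    = λ u v → ladderAdj es L (place L u) (place L v)
  ; sym    = λ u v → symmetric (place L u) (place L v)
  ; irrefl = λ u → irreflexive (place L u)
  }
  where
  symmetric : ∀ u v → ladderAdj es L u v ≡ ladderAdj es L v u
  symmetric (i , p) (j , q) = cong₂ _∨_
    (cong₂ _∧_ (==-sym i j) (∨-comm (suc p ≡ᵇ q) (suc q ≡ᵇ p)))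
    (cong₂ _∧_ (cong₂ _∨_ (∧-comm (p ≡ᵇ 0) (q ≡ᵇ 0)) (∧-comm (p ≡ᵇ L) (q ≡ᵇ L))) (sym (ends es) i j))
  irreflexive : ∀ u → ladderAdj es L u u ≡ false
  irreflexive (i , p) = cong₂ _∨_
    (trans (cong (i == i ∧_) (cong₂ _∨_ (suc≡ᵇ p) (suc≡ᵇ p))) (∧-zeroʳ (i == i)))
    (trans (cong (extreme L p p ∧_) (irrefl (ends es) i)) (∧-zeroʳ (extreme L p p)))

place-injective : ∀ L {u v} → place L u ≡ place L v → u ≡ v
place-injective L {u} {v} e = trans (≡-sym (combine-remQuot {3} (suc L) u))
  (trans (cong₂ combine (cong proj₁ e) (toℕ-injective (cong proj₂ e))) (combine-remQuot {3} (suc L) v))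

level≤ : ∀ L u → proj₂ (place L u) ≤ L
level≤ L u = ℕₚ.≤-pred (toℕ<n (proj₂ (remQuot {3} (suc L) u)))

at : ∀ L → Fin 3 → (p : ℕ) → .(p ≤ L) → Fin (3 * suc L)
at L i p h = combine i (fromℕ< (s≤s h))

place-at : ∀ L i p .(h : p ≤ L) → place L (at L i p h) ≡ (i , p)
place-at L i p h = trans (cong (map₂ toℕ) (remQuot-combine i (fromℕ< (s≤s h)))) (cong (i ,_) (toℕ-fromℕ< (s≤s h)))

at-place : ∀ L u → at L (proj₁ (place L u)) (proj₂ (place L u)) (level≤ L u) ≡ u
at-place L u = place-injective L (place-at L _ _ (level≤ L u))

at-Adj : ∀ es L i p j q .(hp : p ≤ L) .(hq : q ≤ L) → T (ladderAdj es L (i , p) (j , q)) →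
         Adj (ladder es L) (at L i p hp) (at L j q hq)
at-Adj es L i p j q hp hq t = trans (cong₂ (ladderAdj es L) (place-at L i p hp) (place-at L j q hq)) (to T-≡ t)

≡ᵇ-refl : ∀ n → T (n ≡ᵇ n)
≡ᵇ-refl n = ℕₚ.≡⇒≡ᵇ n n refl

step-adj : ∀ es L i p → T (ladderAdj es L (i , p) (i , suc p))
step-adj es L i p = from T-∨ (inj₁ (from T-∧ (from T-≡ (==-refl i) , from T-∨ (inj₁ (≡ᵇ-refl p)))))

bottom-adj : ∀ es L i j → T (adj (ends es) i j) → T (ladderAdj es L (i , 0) (j , 0))
bottom-adj es L i j e = from (T-∨ {i == j ∧ consecutive 0 0}) (inj₂ (from (T-∧ {extreme L 0 0}) (tt , e)))

top-adj : ∀ es L i j → T (adj (ends es) i j) → T (ladderAdj es L (i , L) (j , L))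
top-adj es L i j e = from (T-∨ {i == j ∧ consecutive L L}) (inj₂ (from (T-∧ {extreme L L L})
  (from (T-∨ {(L ≡ᵇ 0) ∧ (L ≡ᵇ 0)}) (inj₂ (from T-∧ (≡ᵇ-refl L , ≡ᵇ-refl L))) , e)))

below : ∀ {p L} → suc p ≤ L → p ≤ L
below = ℕₚ.≤-trans (ℕₚ.n≤1+n _)

raise : ∀ d p {L} → suc d + p ≡ L → suc p ≤ L
raise d p e = ℕₚ.≤-trans (ℕₚ.m≤n+m (suc p) d) (ℕₚ.≤-reflexive (trans (ℕₚ.+-suc d p) e))

descend : ∀ es L P i p .(h : p ≤ L) → (∀ q .(h′ : q ≤ L) → q ≤ p → P (at L i q h′)) →
          WalkIn (ladder es L) P (at L i p h) (at L i 0 z≤n)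
descend es L P i zero    h ok = here (ok 0 z≤n z≤n)
descend es L P i (suc p) h ok = step (ok (suc p) h ℕₚ.≤-refl)
  (trans (sym (ladder es L) (at L i (suc p) h) (at L i p (below h)))
    (at-Adj es L i p i (suc p) (below h) h (step-adj es L i p)))
  (descend es L P i p (below h) λ q hq q≤p → ok q hq (ℕₚ.m≤n⇒m≤1+n q≤p))

ascend : ∀ es L P i d p .(h : p ≤ L) → d + p ≡ L → (∀ q .(h′ : q ≤ L) → p ≤ q → P (at L i q h′)) →
         WalkIn (ladder es L) P (at L i p h) (at L i L ℕₚ.≤-refl)
ascend es L P i zero    p h refl ok = here (ok p h ℕₚ.≤-refl)
ascend es L P i (suc d) p h e    ok = step (ok p h ℕₚ.≤-refl)
  (at-Adj es L i p i (suc p) h (raise d p e) (step-adj es L i p))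
  (ascend es L P i d (suc p) (raise d p e) (trans (ℕₚ.+-suc d p) e)
    λ q hq p<q → ok q hq (ℕₚ.≤-trans (ℕₚ.n≤1+n p) p<q))

-- In a connected graph on three vertices two steps reach everything.
linkedEnds : List (ℕ × ℕ) → Bool
linkedEnds es = allF λ i → allF λ j → reach (adj (ends es)) (λ _ → true) 2 i j

across : ∀ es L P → T (linkedEnds es) → ∀ p .(h : p ≤ L) →
         (∀ i j → T (adj (ends es) i j) → T (ladderAdj es L (i , p) (j , p))) → (∀ i → P (at L i p h)) →
         ∀ i j → WalkIn (ladder es L) P (at L i p h) (at L j p h)
across es L P lk p h adj-p ok i j = reach-sound (adj (ends es)) (λ _ → true) (ladder es L) P (λ i → at L i p h)
  (λ c d e → at-Adj es L c p d p h h (adj-p c d e)) (λ c _ → ok c) 2 i j tt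
  (allF⁻ (r i) (allF⁻ (λ i → allF (r i)) lk i) j)
  where
  r : Fin 3 → Fin 3 → Bool
  r i j = reach (adj (ends es)) (λ _ → true) 2 i j

different : ∀ (i : Fin 3) → ∃ λ j → j ≢ i
different zero    = 1F , λ ()
different (suc i) = 0F , λ ()

-- Every vertex other than `z` is led to the bottom of a leg `j` that avoids `z`: it moves along its
-- own leg without meeting `z`, crosses at an extreme level not containing `z`, and descends leg `j`
-- after a crossing at the top. As `1 ≤ L`, `z` cannot lie on both extreme levels.
ladder-twoConnected : ∀ es → T (linkedEnds es) → ∀ L → 1 ≤ L → TwoConnected (ladder es L)
ladder-twoConnected es lk L 1≤L = ℕₚ.m≤m*n 3 (suc L) , connected , deleted
  where
  G = ladder es L
  root : ∀ u → WalkIn G (λ _ → ⊤) u (at L 0F 0 z≤n)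
  root u = subst (λ w → WalkIn G _ w _) (at-place L u)
    (descend es L _ (proj₁ (place L u)) (proj₂ (place L u)) (level≤ L u) _ ++ʷ
     across es L _ lk 0 z≤n (bottom-adj es L) _ (proj₁ (place L u)) 0F)
  connected : Connected G
  connected u v = root u ++ʷ reverseʷ (root v)
  deleted : ∀ z u v → u ≢ z → v ≢ z → WalkIn G (_≢ z) u v
  deleted z u v u≢z v≢z = anchored u u≢z ++ʷ reverseʷ (anchored v v≢z)
    where
    zi = proj₁ (place L z)
    zp = proj₂ (place L z)
    j  = proj₁ (different zi)
    j≢ = proj₂ (different zi)
    leg≢ : ∀ i p .(h : p ≤ L) → i ≢ zi → at L i p h ≢ z
    leg≢ i p h ne e = ne (cong proj₁ (trans (≡-sym (place-at L i p h)) (cong (place L) e)))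
    level≢ : ∀ i p .(h : p ≤ L) → p ≢ zp → at L i p h ≢ z
    level≢ i p h ne e = ne (cong proj₂ (trans (≡-sym (place-at L i p h)) (cong (place L) e)))
    via-bottom : ∀ i p .(h : p ≤ L) → zp ≢ 0 → (∀ q .(h′ : q ≤ L) → q ≤ p → at L i q h′ ≢ z) →
                 WalkIn G (_≢ z) (at L i p h) (at L j 0 z≤n)
    via-bottom i p h ne ok = descend es L (_≢ z) i p h ok ++ʷ
      across es L (_≢ z) lk 0 z≤n (bottom-adj es L) (λ i → level≢ i 0 z≤n (ne ∘ ≡-sym)) i j
    via-top : ∀ i p (h : p ≤ L) → zp ≢ L → (∀ q .(h′ : q ≤ L) → p ≤ q → at L i q h′ ≢ z) →
              WalkIn G (_≢ z) (at L i p h) (at L j 0 z≤n)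
    via-top i p h ne ok = ascend es L (_≢ z) i (L ∸ p) p h (ℕₚ.m∸n+n≡m h) ok ++ʷ
      across es L (_≢ z) lk L ℕₚ.≤-refl (top-adj es L) (λ i → level≢ i L ℕₚ.≤-refl (ne ∘ ≡-sym)) i j ++ʷ
      descend es L (_≢ z) j L ℕₚ.≤-refl (λ q hq _ → leg≢ j q hq j≢)
    anchored′ : ∀ i p (h : p ≤ L) → at L i p h ≢ z → WalkIn G (_≢ z) (at L i p h) (at L j 0 z≤n)
    anchored′ i p h ne with i ≟ zi
    ... | no i≢ = case zp ℕ.≟ 0 of λ
      { (no  z≢0) → via-bottom i p h z≢0 (λ q hq _ → leg≢ i q hq i≢)
      ; (yes z≡0) → via-top i p h (λ z≡L → ℕₚ.<-irrefl (trans (≡-sym z≡0) z≡L) 1≤L) (λ q hq _ → leg≢ i q hq i≢) }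
    ... | yes refl with ℕₚ.<-cmp p zp
    ...   | tri< p<z _ _ = via-bottom i p h (λ z≡0 → ℕₚ.n≮0 (subst (p <_) z≡0 p<z))
                             (λ q hq q≤p → level≢ i q hq (ℕₚ.<⇒≢ (ℕₚ.≤-<-trans q≤p p<z)))
    ...   | tri> _ _ z<p = via-top i p h (ℕₚ.<⇒≢ (ℕₚ.<-≤-trans z<p h))
                             (λ q hq p≤q → level≢ i q hq (ℕₚ.<⇒≢ (ℕₚ.<-≤-trans z<p p≤q) ∘ ≡-sym))
    ...   | tri≈ _ refl _ = contradiction (at-place L z) ne
    anchored : ∀ w → w ≢ z → WalkIn G (_≢ z) w (at L j 0 z≤n)
    anchored w w≢z = subst (λ w → WalkIn G (_≢ z) w (at L j 0 z≤n)) (at-place L w)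
      (anchored′ (proj₁ (place L w)) (proj₂ (place L w)) (level≤ L w) (w≢z ∘ trans (≡-sym (at-place L w))))

-- Dominating cycles in ladders.

zone : ℕ → ℕ → Fin 3
zone L p = if p ≡ᵇ 0 then 0F else if p ≡ᵇ L then 1F else 2F

-- `combine` sends zone `z` and leg `i` to `3 * z + i`, which is the numbering of `prism`: bottom,
-- top, interior.
corner : Fin 3 → Fin 3 → Fin 9
corner = combine

allF³ : ∀ {k l m} (p : Fin k → Fin l → Fin m → Bool) →
        (allF λ x → allF λ y → allF (p x y)) ≡ true → ∀ x y z → T (p x y z)
allF³ p e x y z = allF⁻ (p x y)
  (allF⁻ (λ y → allF (p x y)) (allF⁻ (λ x → allF λ y → allF (p x y)) (from T-≡ e) x) y) z

same-leg : ∀ z z′ i → corner z i ≡ corner z′ i ⊎ T (adj prism (corner z i) (corner z′ i))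
same-leg z z′ i = Sum.map₁ (==⇒≡ _ _) (to (T-∨ {corner z i == corner z′ i}) (allF³ p refl z z′ i))
  where
  p : Fin 3 → Fin 3 → Fin 3 → Bool
  p z z′ i = corner z i == corner z′ i ∨ adj prism (corner z i) (corner z′ i)

same-end : ∀ z i j → z ≢ 2F → i ≢ j → T (adj prism (corner z i) (corner z j))
same-end z i j z≢2 i≢j with to (T-∨ {z == 2F}) (allF³ p refl z i j)
  where
  p : Fin 3 → Fin 3 → Fin 3 → Bool
  p z i j = z == 2F ∨ i == j ∨ adj prism (corner z i) (corner z j)
... | inj₁ e = contradiction (==⇒≡ _ _ e) z≢2
... | inj₂ t with to (T-∨ {i == j}) t
...   | inj₁ e = contradiction (==⇒≡ _ _ e) i≢j
...   | inj₂ r = r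

end-single : ∀ z i → T (single< 6 (corner z i)) → z ≢ 2F
end-single z i t refl = T-not (allF⁻ (λ i → not (single< 6 (corner 2F i))) tt i) t

interior : ∀ c → ¬ T (single< 6 c) → ∃ λ i → corner 2F i ≡ c
interior c ns with to (T-∨ {single< 6 c}) (allF⁻ (λ c → single< 6 c ∨ anyF λ i → corner 2F i == c) tt c)
... | inj₁ t = contradiction t ns
... | inj₂ t with anyF⁻ _ t
...   | i , e = i , ==⇒≡ _ _ e

zone-0 : ∀ L p → zone L p ≡ 0F → p ≡ 0
zone-0 L zero    e = refl
zone-0 L (suc p) e with suc p ≡ᵇ L
zone-0 L (suc p) () | true
zone-0 L (suc p) () | false

zone-1 : ∀ L p → zone L p ≡ 1F → p ≡ L
zone-1 L (suc p) e with suc p ≡ᵇ L in eq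
... | true = ℕₚ.≡ᵇ⇒≡ (suc p) L (from T-≡ eq)

zone-L : ∀ L → 1 ≤ L → zone L L ≡ 1F
zone-L (suc L) _ rewrite to T-≡ (≡ᵇ-refl L) = refl

-- The vertices of the extreme levels are the single classes of `prism`, and the inner levels of
-- each leg form one further class. Both ends of `prism` are triangles, so any `es` fits.
ladder-no-dominating-cycle : ∀ es L → ¬ HasDominatingCycle (ladder es (3 + L))
ladder-no-dominating-cycle es L′ =
  no-dominating-cycle (adj prism) (single< 6) 15 prism-safe G cls h-adj h-single h-core
  where
  L = 3 + L′
  G = ladder es L
  cls′ : Fin 3 × ℕ → Fin 9
  cls′ (i , p) = corner (zone L p) i
  cls : Fin (order G) → Fin 9
  cls = cls′ ∘ place L
  adj-cls : ∀ u v → T (ladderAdj es L u v) → cls′ u ≡ cls′ v ⊎ T (adj prism (cls′ u) (cls′ v))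
  adj-cls (i , p) (j , q) t with to (T-∨ {i == j ∧ consecutive p q}) t
  ... | inj₁ t₁ with ==⇒≡ i j (proj₁ (to (T-∧ {i == j}) t₁))
  ...   | refl = same-leg (zone L p) (zone L q) i
  adj-cls (i , p) (j , q) t | inj₂ t₂ with to (T-∧ {extreme L p q}) t₂
  ... | ex , ij = inj₂ (at-end (to (T-∨ {(p ≡ᵇ 0) ∧ (q ≡ᵇ 0)}) ex))
    where
    i≢j : i ≢ j
    i≢j refl = subst T (irrefl (ends es) i) ij
    at-end : T ((p ≡ᵇ 0) ∧ (q ≡ᵇ 0)) ⊎ T ((p ≡ᵇ L) ∧ (q ≡ᵇ L)) → T (adj prism (cls′ (i , p)) (cls′ (j , q)))
    at-end (inj₁ e) with ℕₚ.≡ᵇ⇒≡ p 0 (proj₁ (to (T-∧ {p ≡ᵇ 0}) e)) | ℕₚ.≡ᵇ⇒≡ q 0 (proj₂ (to (T-∧ {p ≡ᵇ 0}) e))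
    ... | refl | refl = same-end 0F i j (λ ()) i≢j
    at-end (inj₂ e) with ℕₚ.≡ᵇ⇒≡ p L (proj₁ (to (T-∧ {p ≡ᵇ L}) e)) | ℕₚ.≡ᵇ⇒≡ q L (proj₂ (to (T-∧ {p ≡ᵇ L}) e))
    ... | refl | refl = subst (λ z → T (adj prism (corner z i) (corner z j))) (≡-sym (zone-L L (s≤s z≤n)))
                          (same-end 1F i j (λ ()) i≢j)
  h-adj : ∀ u v → Adj G u v → cls u ≡ cls v ⊎ T (adj prism (cls u) (cls v))
  h-adj u v uv = adj-cls (place L u) (place L v) (from T-≡ uv)
  level : ∀ p q → zone L p ≢ 2F → zone L p ≡ zone L q → p ≡ q
  level p q ne e with zone L p in zp
  ... | 0F = trans (zone-0 L p zp) (≡-sym (zone-0 L q (≡-sym e)))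
  ... | 1F = trans (zone-1 L p zp) (≡-sym (zone-1 L q (≡-sym e)))
  ... | 2F = contradiction refl ne
  h-single : ∀ u v → T (single< 6 (cls u)) → cls u ≡ cls v → u ≡ v
  h-single u v sg e with combine-injective {3} {3} (zone L (proj₂ (place L u))) (proj₁ (place L u)) _ _ e
  ... | ez , ei = place-injective L (cong₂ _,_ ei (level _ _ (end-single _ (proj₁ (place L u)) sg) ez))
  h-core : ∀ c → ¬ T (single< 6 c) → ∃ λ u → ∃ λ v → Adj G u v × cls u ≡ c × cls v ≡ c
  h-core c ns with interior c ns
  -- Levels 1 and 2 are both inner because the top level is at least 3.
  ... | i , e = at L i 1 h₁ , at L i 2 h₂ , at-Adj es L i 1 i 2 h₁ h₂ (step-adj es L i 1)
              , trans (cong cls′ (place-at L i 1 h₁)) e , trans (cong cls′ (place-at L i 2 h₂)) e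
    where
    h₁ : 1 ≤ L
    h₁ = s≤s z≤n
    h₂ : 2 ≤ L
    h₂ = s≤s (s≤s z≤n)

-- Shortening ladders.

-- Deletes level t + 1; consecutiveness survives this on levels other than t and t + 1.
skip : ℕ → ℕ → ℕ
skip zero    p       = ℕ.pred p
skip (suc t) zero    = zero
skip (suc t) (suc p) = suc (skip t p)

Avoids : ℕ → ℕ → Set
Avoids t p = p ≢ t × p ≢ suc t

avoids-pred : ∀ {t p} → Avoids (suc t) (suc p) → Avoids t p
avoids-pred (a , b) = a ∘ cong suc , b ∘ cong suc

skip-≡ᵇ : ∀ t p q → Avoids t p → Avoids t q → (p ≡ᵇ q) ≡ (skip t p ≡ᵇ skip t q)
skip-≡ᵇ zero zero          q             (a , _) _       = contradiction refl a
skip-≡ᵇ zero (suc p)       zero          _       (a , _) = contradiction refl a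
skip-≡ᵇ zero (suc p)       (suc q)       _       _       = refl
skip-≡ᵇ (suc t) zero    zero    _ _ = refl
skip-≡ᵇ (suc t) zero    (suc q) _ _ = refl
skip-≡ᵇ (suc t) (suc p) zero    _ _ = refl
skip-≡ᵇ (suc t) (suc p) (suc q) a b = skip-≡ᵇ t p q (avoids-pred a) (avoids-pred b)

skip-0 : ∀ t p → Avoids t p → (p ≡ᵇ 0) ≡ (skip t p ≡ᵇ 0)
skip-0 zero    zero          (a , _) = contradiction refl a
skip-0 zero    (suc zero)    (_ , b) = contradiction refl b
skip-0 zero    (suc (suc p)) _       = refl
skip-0 (suc t) zero          _       = refl
skip-0 (suc t) (suc p)       _       = refl

skip-suc : ∀ t p q → Avoids t p → Avoids t q → (suc p ≡ᵇ q) ≡ (suc (skip t p) ≡ᵇ skip t q)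
skip-suc zero    zero    q             (a , _) _       = contradiction refl a
skip-suc zero    (suc p) zero          _       (a , _) = contradiction refl a
skip-suc zero    (suc p) (suc q)       _       _       = refl
skip-suc (suc t) p       zero          _       _       = refl
skip-suc (suc t) zero    (suc q)       _       b       = skip-0′ t q (avoids-pred b)
  where
  skip-0′ : ∀ t q → Avoids t q → (0 ≡ᵇ q) ≡ (0 ≡ᵇ skip t q)
  skip-0′ zero    zero          (a , _) = contradiction refl a
  skip-0′ zero    (suc zero)    (_ , b) = contradiction refl b
  skip-0′ zero    (suc (suc q)) _       = refl
  skip-0′ (suc t) zero          _       = refl
  skip-0′ (suc t) (suc q)       _       = refl
skip-suc (suc t) (suc p) (suc q)       a       b       = skip-suc t p q (avoids-pred a) (avoids-pred b)

skip-top : ∀ t p L → t ≤ L → Avoids t p → (p ≡ᵇ suc L) ≡ (skip t p ≡ᵇ L)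
skip-top zero    zero    L       _         (a , _) = contradiction refl a
skip-top zero    (suc p) L       _         _       = refl
skip-top (suc t) zero    (suc L) _         _       = refl
skip-top (suc t) (suc p) (suc L) (s≤s t≤L) a       = skip-top t p L t≤L (avoids-pred a)

skip-≤ : ∀ t p L → t ≤ L → p ≤ suc L → p ≢ t → skip t p ≤ L
skip-≤ zero    zero    L       _         _         _ = z≤n
skip-≤ zero    (suc p) L       _         (s≤s p≤L) _ = p≤L
skip-≤ (suc t) zero    (suc L) _         _         _ = z≤n
skip-≤ (suc t) (suc p) (suc L) (s≤s t≤L) (s≤s p≤L) a = s≤s (skip-≤ t p L t≤L p≤L (a ∘ cong suc))

-- An induced embedding in coordinates. Levels are plain numbers, so passing to a shorter ladder
-- changes only `level`.
record InLadder (F : Graph) (es : List (ℕ × ℕ)) (L : ℕ) : Set where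
  field
    leg       : Fin (order F) → Fin 3
    level     : Fin (order F) → ℕ
    injective : ∀ {u v} → leg u ≡ leg v → level u ≡ level v → u ≡ v
    bounded   : ∀ u → level u ≤ L
    adjacency : ∀ u v → adj F u v ≡ ladderAdj es L (leg u , level u) (leg v , level v)

≺⇒InLadder : ∀ {F es L} → F ≺ ladder es L → InLadder F es L
≺⇒InLadder {L = L} (f , inj , f-adj) = record
  { leg       = proj₁ ∘ place L ∘ f
  ; level     = proj₂ ∘ place L ∘ f
  ; injective = λ e₁ e₂ → inj (place-injective L (cong₂ _,_ e₁ e₂))
  ; bounded   = level≤ L ∘ f
  ; adjacency = f-adj
  }

InLadder⇒≺ : ∀ {F es L} → InLadder F es L → F ≺ ladder es L
InLadder⇒≺ {F} {es} {L} e = f , f-inj , f-adj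
  where
  open InLadder e
  f : Fin (order F) → Fin (3 * suc L)
  f u = at L (leg u) (level u) (bounded u)
  place-f : ∀ u → place L (f u) ≡ (leg u , level u)
  place-f u = place-at L (leg u) (level u) (bounded u)
  f-inj : Injective _≡_ _≡_ f
  f-inj {u} {v} q = injective (cong proj₁ q′) (cong proj₂ q′)
    where
    q′ : (leg u , level u) ≡ (leg v , level v)
    q′ = trans (≡-sym (place-f u)) (trans (cong (place L) q) (place-f v))
  f-adj : ∀ u v → adj F u v ≡ adj (ladder es L) (f u) (f v)
  f-adj u v = trans (adjacency u v) (cong₂ (ladderAdj es L) (≡-sym (place-f u)) (≡-sym (place-f v)))

skip-level : ∀ {F es L} t → t ≤ L → (e : InLadder F es (suc L)) →
             (∀ u → Avoids t (InLadder.level e u)) → InLadder F es L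
skip-level {F} {es} {L} t t≤L e av = record
  { leg       = leg
  ; level     = skip t ∘ level
  ; injective = λ {u} {v} e₁ e₂ → injective e₁ (ℕₚ.≡ᵇ⇒≡ _ _
                  (subst T (≡-sym (skip-≡ᵇ t (level u) (level v) (av u) (av v)))
                  (ℕₚ.≡⇒≡ᵇ _ _ e₂)))
  ; bounded   = λ u → skip-≤ t (level u) L t≤L (bounded u) (proj₁ (av u))
  ; adjacency = λ u v → trans (adjacency u v) (cong₂ _∨_
      (cong (leg u == leg v ∧_) (cong₂ _∨_ (skip-suc t _ _ (av u) (av v)) (skip-suc t _ _ (av v) (av u))))
      (cong (_∧ adj (ends es) (leg u) (leg v)) (cong₂ _∨_
        (cong₂ _∧_ (skip-0 t _ (av u)) (skip-0 t _ (av v)))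
        (cong₂ _∧_ (skip-top t _ L t≤L (av u)) (skip-top t _ L t≤L (av v))))))
  }
  where open InLadder e

-- Pigeonhole: `n` vertices cannot meet all of the `n + 1` blocks of levels `2k`, `2k + 1`.
unused-half : ∀ {n} (level : Fin n → ℕ) → ∃ λ (k : Fin (suc n)) → ∀ u → ⌊ level u /2⌋ ≢ toℕ k
unused-half {n} level = decidable-stable (any? (λ k → all? (λ u → ¬? (⌊ level u /2⌋ ℕ.≟ toℕ k)))) λ none →
  let user : ∀ (k : Fin (suc n)) → ∃ λ u → ⌊ level u /2⌋ ≡ toℕ k
      user k = let u , ¬¬e = ¬∀⟶∃¬ n _ (λ u → ¬? (⌊ level u /2⌋ ℕ.≟ toℕ k)) (λ h → none (k , h))
               in u , decidable-stable (_ ℕ.≟ _) ¬¬e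
      k , l , k<l , e = pigeonhole (ℕₚ.n<1+n n) (proj₁ ∘ user)
  in contradiction (trans (≡-sym (proj₂ (user k))) (trans (cong (⌊_/2⌋ ∘ level) e) (proj₂ (user l)))) (ℕₚ.<⇒≢ k<l)

shrink : ∀ {F es} L → order F + order F ≤ L → InLadder F es (suc L) → InLadder F es L
shrink {F} L 2n≤L e with unused-half (InLadder.level e)
... | k , unused = skip-level (toℕ k + toℕ k) 2k≤L e λ u →
      (λ q → unused u (trans (cong ⌊_/2⌋ q) (≡-sym (ℕₚ.n≡⌊n+n/2⌋ (toℕ k)))))
    -- Half of a successor `suc m` is the ceiling of `m / 2`, so level `2k + 1` also lies in block
    -- `k`.
    , (λ q → unused u (trans (cong ⌊_/2⌋ q) (≡-sym (ℕₚ.n≡⌈n+n/2⌉ (toℕ k)))))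
  where
  k≤n : toℕ k ≤ order F
  k≤n = ℕₚ.≤-pred (toℕ<n k)
  2k≤L : toℕ k + toℕ k ≤ L
  2k≤L = ℕₚ.≤-trans (ℕₚ.+-mono-≤ k≤n k≤n) 2n≤L

shrink* : ∀ {F es} d → InLadder F es (d + (order F + order F)) → InLadder F es (order F + order F)
shrink* zero    e = e
shrink* (suc d) e = shrink* d (shrink _ (ℕₚ.m≤n+m _ d) e)

ladderExcludes : List (ℕ × ℕ) → Graph → Bool
ladderExcludes es F = not (embeds F (ladder es (order F + order F)))

-- An embedding in a longer ladder shrinks to one in the ladder of top level `order F + order F`,
-- where the test was made.
ladderExcludes-sound : ∀ es F → T (ladderExcludes es F) → ∀ L → order F + order F ≤ L → ¬ (F ≺ ladder es L)
ladderExcludes-sound es F q L 2n≤L F≺ = T-not q (embeds-complete F (ladder es (order F + order F))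
  (InLadder⇒≺ {F} {es} (shrink* {F} {es} (L ∸ (order F + order F))
    (≺⇒InLadder {F} {es} (subst (λ L → F ≺ ladder es L) (≡-sym (ℕₚ.m∸n+n≡m 2n≤L)) F≺)))))

-- The families and their forbidden subgraphs

P₂ P₃ P₆ P₇ K₃ K₄ C₄ C₅ C₆ C₇ : Graph
P₂ = fromEdges 2 ((0 , 1) ∷ [])
P₃ = fromEdges 3 ((0 , 1) ∷ (1 , 2) ∷ [])
P₆ = fromEdges 6 ((0 , 1) ∷ (1 , 2) ∷ (2 , 3) ∷ (3 , 4) ∷ (4 , 5) ∷ [])
P₇ = fromEdges 7 ((0 , 1) ∷ (1 , 2) ∷ (2 , 3) ∷ (3 , 4) ∷ (4 , 5) ∷ (5 , 6) ∷ [])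
K₃ = fromEdges 3 ((0 , 1) ∷ (1 , 2) ∷ (2 , 0) ∷ [])
K₄ = fromEdges 4 ((0 , 1) ∷ (1 , 2) ∷ (2 , 0) ∷ (0 , 3) ∷ (1 , 3) ∷ (2 , 3) ∷ [])
C₄ = fromEdges 4 ((0 , 1) ∷ (1 , 2) ∷ (2 , 3) ∷ (3 , 0) ∷ [])
C₅ = fromEdges 5 ((0 , 1) ∷ (1 , 2) ∷ (2 , 3) ∷ (3 , 4) ∷ (4 , 0) ∷ [])
C₆ = fromEdges 6 ((0 , 1) ∷ (1 , 2) ∷ (2 , 3) ∷ (3 , 4) ∷ (4 , 5) ∷ (5 , 0) ∷ [])
C₇ = fromEdges 7 ((0 , 1) ∷ (1 , 2) ∷ (2 , 3) ∷ (3 , 4) ∷ (4 , 5) ∷ (5 , 6) ∷ (6 , 0) ∷ [])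

Z₂ Z₃ B₁₁ B₁₃ B₂₂ N₁₁₂ : Graph
Z₂   = fromEdges 5 ((0 , 1) ∷ (1 , 2) ∷ (2 , 0) ∷ (0 , 3) ∷ (3 , 4) ∷ [])
Z₃   = fromEdges 6 ((0 , 1) ∷ (1 , 2) ∷ (2 , 0) ∷ (0 , 3) ∷ (3 , 4) ∷ (4 , 5) ∷ [])
B₁₁  = fromEdges 5 ((0 , 1) ∷ (1 , 2) ∷ (2 , 0) ∷ (0 , 3) ∷ (1 , 4) ∷ [])
B₁₃  = fromEdges 7 ((0 , 1) ∷ (1 , 2) ∷ (2 , 0) ∷ (0 , 3) ∷ (1 , 4) ∷ (4 , 5) ∷ (5 , 6) ∷ [])
B₂₂  = fromEdges 7 ((0 , 1) ∷ (1 , 2) ∷ (2 , 0) ∷ (0 , 3) ∷ (3 , 4) ∷ (1 , 5) ∷ (5 , 6) ∷ [])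
N₁₁₂ = fromEdges 7 ((0 , 1) ∷ (1 , 2) ∷ (2 , 0) ∷ (0 , 3) ∷ (1 , 4) ∷ (2 , 5) ∷ (5 , 6) ∷ [])

-- Two triangles joined by a path of length d (a common vertex for d = 0).
TT₀ TT₁ TT₂ TT₃ : Graph
TT₀ = fromEdges 5 ((0 , 1) ∷ (1 , 2) ∷ (2 , 0) ∷ (0 , 3) ∷ (3 , 4) ∷ (4 , 0) ∷ [])
TT₁ = fromEdges 6 ((0 , 1) ∷ (1 , 2) ∷ (2 , 0) ∷ (0 , 3) ∷ (3 , 4) ∷ (4 , 5) ∷ (5 , 3) ∷ [])
TT₂ = fromEdges 7 ((0 , 1) ∷ (1 , 2) ∷ (2 , 0) ∷ (0 , 3) ∷ (3 , 4) ∷ (4 , 5) ∷ (5 , 6) ∷ (6 , 4) ∷ [])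
TT₃ = fromEdges 8 ((0 , 1) ∷ (1 , 2) ∷ (2 , 0) ∷ (0 , 3) ∷ (3 , 4) ∷ (4 , 5) ∷ (5 , 6) ∷ (6 , 7) ∷ (7 , 5) ∷ [])

-- S with indices is the spider with legs of these lengths; H₂₂ is the tree with two adjacent vertices of
-- degree 3; K₂+3K₁ and cricket are joins, cricket being K₁ + (K₂ ∪ 2K₁).
K₁₄ S₁₁₂ S₁₂₂ S₁₁₃ H₂₂ dart cricket K₂+3K₁ : Graph
K₁₄     = fromEdges 5 ((0 , 1) ∷ (0 , 2) ∷ (0 , 3) ∷ (0 , 4) ∷ [])
S₁₁₂    = fromEdges 5 ((0 , 1) ∷ (0 , 2) ∷ (0 , 3) ∷ (3 , 4) ∷ [])
S₁₂₂    = fromEdges 6 ((0 , 1) ∷ (0 , 2) ∷ (2 , 3) ∷ (0 , 4) ∷ (4 , 5) ∷ [])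
S₁₁₃    = fromEdges 6 ((0 , 1) ∷ (0 , 2) ∷ (0 , 3) ∷ (3 , 4) ∷ (4 , 5) ∷ [])
H₂₂     = fromEdges 6 ((0 , 1) ∷ (0 , 2) ∷ (0 , 3) ∷ (1 , 4) ∷ (1 , 5) ∷ [])
dart    = fromEdges 5 ((0 , 1) ∷ (0 , 2) ∷ (0 , 3) ∷ (1 , 2) ∷ (2 , 3) ∷ (0 , 4) ∷ [])
cricket = fromEdges 5 ((0 , 1) ∷ (0 , 2) ∷ (0 , 3) ∷ (0 , 4) ∷ (1 , 2) ∷ [])
K₂+3K₁  = fromEdges 5 ((0 , 1) ∷ (0 , 2) ∷ (0 , 3) ∷ (0 , 4) ∷ (1 , 2) ∷ (1 , 3) ∷ (1 , 4) ∷ [])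

-- 𝒞₂ consists of two triangles a₀a₁a₂ (nodes 0-2) and b₀b₁b₂ (nodes 3-5) and of cliques Qᵢ (nodes 6-8)
-- complete to the adjacent vertices aᵢ and bᵢ; 𝒞₃ lacks the edges aᵢbᵢ.
prism-ends : List (ℕ × ℕ)
prism-ends = (0 , 1) ∷ (0 , 2) ∷ (1 , 2) ∷ (3 , 4) ∷ (3 , 5) ∷ (4 , 5) ∷
  (0 , 6) ∷ (3 , 6) ∷ (1 , 7) ∷ (4 , 7) ∷ (2 , 8) ∷ (5 , 8) ∷ []

𝒞₂ 𝒞₃ : Pattern
𝒞₂ = record { singles = 6 ; copied = 3 ; clique = true
            ; edges = (0 , 3) ∷ (1 , 4) ∷ (2 , 5) ∷ prism-ends }
𝒞₃ = record { singles = 6 ; copied = 3 ; clique = true ; edges = prism-ends }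

-- In the other patterns {0, 1} is a cut leaving three components that contain edges, one of which a cycle has
-- to miss. 𝒟 and ℬ are K₂ + 3Kₙ and 2K₁ + 3Kₙ, and 𝒮 is 2K₁ + 3K₁ₙ. In ℰ the cut is complete to the
-- leaves only of three stars K₁ₙ. In 𝒬 the components are two cliques complete to the cut and an edge joined
-- to it by a perfect matching.
𝒟 ℬ 𝒮 ℰ 𝒬 : Pattern
𝒟 = record { singles = 2 ; copied = 3 ; clique = true
           ; edges = (0 , 1) ∷ (0 , 2) ∷ (0 , 3) ∷ (0 , 4) ∷ (1 , 2) ∷ (1 , 3) ∷ (1 , 4) ∷ [] }
ℬ = record { singles = 2 ; copied = 3 ; clique = true
           ; edges = (0 , 2) ∷ (0 , 3) ∷ (0 , 4) ∷ (1 , 2) ∷ (1 , 3) ∷ (1 , 4) ∷ [] }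
𝒮 = record { singles = 5 ; copied = 3 ; clique = false
           ; edges = (0 , 2) ∷ (0 , 3) ∷ (0 , 4) ∷ (0 , 5) ∷ (0 , 6) ∷ (0 , 7) ∷
                     (1 , 2) ∷ (1 , 3) ∷ (1 , 4) ∷ (1 , 5) ∷ (1 , 6) ∷ (1 , 7) ∷
                     (2 , 5) ∷ (3 , 6) ∷ (4 , 7) ∷ [] }
ℰ = record { singles = 5 ; copied = 3 ; clique = false
           ; edges = (0 , 5) ∷ (0 , 6) ∷ (0 , 7) ∷ (1 , 5) ∷ (1 , 6) ∷ (1 , 7) ∷
                     (2 , 5) ∷ (3 , 6) ∷ (4 , 7) ∷ [] }
𝒬 = record { singles = 4 ; copied = 2 ; clique = true
           ; edges = (0 , 2) ∷ (1 , 3) ∷ (2 , 3) ∷ (0 , 4) ∷ (0 , 5) ∷ (1 , 4) ∷ (1 , 5) ∷ [] }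

star triangle : List (ℕ × ℕ)
star     = (0 , 1) ∷ (1 , 2) ∷ []
triangle = (0 , 1) ∷ (1 , 2) ∷ (2 , 0) ∷ []

all⇒All : ∀ {A : Set} {P : A → Set} (p : A → Bool) → (∀ x → T (p x) → P x) → ∀ xs → all p xs ≡ true → All P xs
all⇒All p h xs e = All.map (λ {x} → h x) (all⁺ p xs (from T-≡ e))

-- Families of obstructions and the subgraphs they exclude.

Obstruction : (ℕ → Graph) → Set
Obstruction G = ∀ n → TwoConnected (G n) × n ≤ order (G n) × ¬ HasDominatingCycle (G n)

-- Two copies are the minimum for `twoConnected-sound` and `cyclic-sound`.
blowups : Pattern → ℕ → Graph
blowups 𝒫 n = blowup 𝒫 (2 + n)

-- 16 is twice the order of `TT₃`, the largest graph to be excluded from ladders.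
ladders : List (ℕ × ℕ) → ℕ → Graph
ladders es n = ladder es (16 + n)

blowups-obstruct : ∀ 𝒫 → (1 ℕ.≤ᵇ copied 𝒫) ∧ twoConnected 𝒫 ≡ true →
  ∀ C k fuel → alwaysSafe (adj C) (single< k) fuel ≡ true → ∀ ρ → cyclic 𝒫 C k ρ ≡ true → Obstruction (blowups 𝒫)
blowups-obstruct 𝒫 e C k fuel sf ρ cyc n =
    twoConnected-sound 𝒫 (proj₂ (to (T-∧ {1 ℕ.≤ᵇ copied 𝒫}) (from T-≡ e))) n
  , large (copied 𝒫) (ℕₚ.≤ᵇ⇒≤ 1 (copied 𝒫) (proj₁ (to (T-∧ {1 ℕ.≤ᵇ copied 𝒫}) (from T-≡ e))))
  , cyclic-sound 𝒫 C k fuel sf ρ (from T-≡ cyc) n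
  where
  large : ∀ t → 1 ≤ t → n ≤ singles 𝒫 + t * (2 + n)
  large (suc t) _ = ℕₚ.≤-trans (ℕₚ.m≤n+m n 2) (ℕₚ.≤-trans (ℕₚ.m≤m+n (2 + n) (t * (2 + n))) (ℕₚ.m≤n+m _ (singles 𝒫)))

ladders-obstruct : ∀ es → linkedEnds es ≡ true → Obstruction (ladders es)
ladders-obstruct es e n =
    ladder-twoConnected es (from T-≡ e) (16 + n) (s≤s z≤n)
  , ℕₚ.≤-trans (ℕₚ.m≤n+m n 17) (ℕₚ.m≤m+n (17 + n) _)
  , ladder-no-dominating-cycle es (13 + n)

Avoiding : Graph → List Graph → Set
Avoiding G = All (λ F → ¬ (F ≺ G))

blowups-avoid : ∀ 𝒫 𝓕 → all (excludes 𝒫) 𝓕 ≡ true → ∀ n → Avoiding (blowups 𝒫 n) 𝓕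
blowups-avoid 𝒫 𝓕 e n = all⇒All (excludes 𝒫) (λ F q → excludes-sound 𝒫 F q (2 + n)) 𝓕 e

ladders-avoid : ∀ es 𝓕 → all (λ F → (order F + order F ℕ.≤ᵇ 16) ∧ ladderExcludes es F) 𝓕 ≡ true →
                ∀ n → Avoiding (ladders es n) 𝓕
ladders-avoid es 𝓕 e n = all⇒All _ (λ F q →
  ladderExcludes-sound es F (proj₂ (to (T-∧ {order F + order F ℕ.≤ᵇ 16}) q)) (16 + n)
  (ℕₚ.≤-trans (ℕₚ.≤ᵇ⇒≤ (order F + order F) 16 (proj₁ (to T-∧ q))) (ℕₚ.m≤m+n 16 n))) 𝓕 e

graph-avoids : ∀ G 𝓕 → all (λ F → not (embeds F G)) 𝓕 ≡ true → Avoiding G 𝓕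
graph-avoids G 𝓕 = all⇒All (λ F → not (embeds F G)) (λ F q F≺G → T-not q (embeds-complete F G F≺G)) 𝓕

inherit : ∀ {H G 𝓕} → H ≺ G → Avoiding G 𝓕 → Avoiding H 𝓕
inherit {H} {G} H≺G = All.map λ {F} F⊀G F≺H → F⊀G (≺-trans {F} {H} {G} F≺H H≺G)

-- Graphs forced by forbidden subgraphs.

Nonempty : Graph → Set
Nonempty H = Connected H × 1 ≤ order H

classified : ∀ S 𝓕 targets → closed (K₁ ∷ S) 𝓕 ≡ true → all (λ s → any (embeds s) targets) (K₁ ∷ S) ≡ true →
             ∀ H → Nonempty H → Avoiding H 𝓕 → Any (H ≺_) targets
classified S 𝓕 targets cl e H (conn , ne) free with find (classify S 𝓕 cl H conn ne free)
... | s , s∈ , H≺s with find (any⁻ (embeds s) targets (All.lookup (all⁺ _ (K₁ ∷ S) (from T-≡ e)) s∈))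
...   | t , t∈ , q = Any.map (λ { refl → ≺-trans {H} {s} {t} H≺s (embeds-sound s t q) }) t∈

-- In the instances below, forbidden graphs excluded by the same host stand together, so that the
-- lists can be assembled host by host with `++⁺`.
Forces : List Graph → List Graph → Set
Forces 𝓕 targets = ∀ H → Nonempty H → Avoiding H 𝓕 → Any (H ≺_) targets

force-P₃ : Forces (K₃ ∷ C₄ ∷ P₄ ∷ K₁₃ ∷ []) (P₃ ∷ [])
force-P₃ = classified (P₂ ∷ P₃ ∷ []) _ _ refl refl

force-K₁₃ : Forces (K₃ ∷ C₄ ∷ P₄ ∷ K₁₄ ∷ []) (K₁₃ ∷ [])
force-K₁₃ = classified (P₂ ∷ P₃ ∷ K₁₃ ∷ []) _ _ refl refl

force-P₄ : Forces (K₃ ∷ C₄ ∷ C₅ ∷ K₁₃ ∷ P₅ ∷ []) (P₄ ∷ [])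
force-P₄ = classified (P₂ ∷ P₃ ∷ P₄ ∷ []) _ _ refl refl

force-P₅ : Forces (K₃ ∷ C₄ ∷ C₅ ∷ C₆ ∷ P₆ ∷ K₁₃ ∷ []) (P₅ ∷ [])
force-P₅ = classified (P₂ ∷ P₃ ∷ P₄ ∷ P₅ ∷ []) _ _ refl refl

-- A connected graph without induced `P₄` and `C₄` has a vertex adjacent to all others. Deleting it
-- leaves, by `K₄⁻`, disjoint cliques, by `K₁₃` at most two, by `K₄` of order at most 2, and by
-- `TT₀` not two edges.
force-Z₁ : Forces (P₄ ∷ C₄ ∷ K₁₃ ∷ K₄⁻ ∷ K₄ ∷ TT₀ ∷ []) (Z₁ ∷ [])
force-Z₁ = classified (P₂ ∷ P₃ ∷ K₃ ∷ Z₁ ∷ []) _ _ refl refl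

-- Longer induced cycles contain `P₆`, so only trees remain, of maximum degree 3 by `K₁₄`. Two
-- vertices of degree 3 would give `H₂₂`, `S₁₁₃` or `P₆` according to their distance, and `S₁₁₃`
-- limits the legs of a spider to length 2.
force-K₁₃* : Forces (K₃ ∷ C₅ ∷ C₆ ∷ P₆ ∷ S₁₁₃ ∷ H₂₂ ∷ C₄ ∷ K₁₄ ∷ []) (K₁₃* ∷ [])
force-K₁₃* = classified (P₂ ∷ P₃ ∷ P₄ ∷ P₅ ∷ K₁₃ ∷ S₁₁₂ ∷ S₁₂₂ ∷ K₁₃* ∷ []) _ _ refl refl

-- Again some vertex is adjacent to all others. If the rest contains an induced `P₃`, then by
-- `dart`, `K₄` and `K₂+3K₁` it equals `P₃`, which gives `K₄⁻`. Otherwise it consists of at most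
-- three components of order at most 2.
force-W-K₄⁻ : Forces (P₄ ∷ C₄ ∷ K₁₄ ∷ dart ∷ K₄ ∷ K₂+3K₁ ∷ []) (W ∷ K₄⁻ ∷ [])
force-W-K₄⁻ = classified (P₂ ∷ P₃ ∷ K₁₃ ∷ K₃ ∷ Z₁ ∷ cricket ∷ TT₀ ∷ W* ∷ W ∷ K₄⁻ ∷ []) _ _ refl refl

force-W* : Forces (P₄ ∷ C₄ ∷ K₁₄ ∷ K₄ ∷ K₄⁻ ∷ W ∷ []) (W* ∷ [])
force-W* = classified (P₂ ∷ P₃ ∷ K₁₃ ∷ K₃ ∷ Z₁ ∷ cricket ∷ TT₀ ∷ W* ∷ []) _ _ refl refl

-- All blocks are edges or triangles, and no vertex lies in three of them. Two triangles are
-- impossible: at distance 4 or more they give `P₇`. What remains is a path or a triangle with at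
-- most one path at each vertex, of lengths limited by `P₇`, `B₁₃`, `B₂₂` and `N₁₁₂`.
force-Z₄-B₁₂-N₁₁₁ : Forces
  (K₁₃ ∷ K₄⁻ ∷ C₅ ∷ C₆ ∷ C₇ ∷ P₇ ∷ B₁₃ ∷ N₁₁₂ ∷ C₄ ∷ B₂₂ ∷ K₄ ∷ TT₀ ∷ TT₁ ∷ TT₂ ∷ TT₃ ∷ [])
  (Z₄ ∷ B₁₂ ∷ N₁₁₁ ∷ [])
force-Z₄-B₁₂-N₁₁₁ = classified
  (P₂ ∷ P₃ ∷ P₄ ∷ P₅ ∷ P₆ ∷ K₃ ∷ Z₁ ∷ Z₂ ∷ Z₃ ∷ Z₄ ∷ B₁₁ ∷ B₁₂ ∷ N₁₁₁ ∷ []) _ _ refl refl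

𝒞₂-obstruct : Obstruction (blowups 𝒞₂)
𝒞₂-obstruct = blowups-obstruct 𝒞₂ refl prism 6 15 prism-safe id refl

-- The extra edges of `prism` do no harm: it only has to admit all steps that occur.
𝒞₃-obstruct : Obstruction (blowups 𝒞₃)
𝒞₃-obstruct = blowups-obstruct 𝒞₃ refl prism 6 15 prism-safe id refl

𝒟-obstruct : Obstruction (blowups 𝒟)
𝒟-obstruct = blowups-obstruct 𝒟 refl book 2 8 book-safe id refl

ℬ-obstruct : Obstruction (blowups ℬ)
ℬ-obstruct = blowups-obstruct ℬ refl book 2 8 book-safe id refl

-- Each star centre shares its class with its leaves, nodes 5 to 7.
𝒮-obstruct : Obstruction (blowups 𝒮)
𝒮-obstruct = blowups-obstruct 𝒮 refl book 2 8 book-safe (lookup (0F ∷ 1F ∷ 2F ∷ 3F ∷ 4F ∷ 2F ∷ 3F ∷ 4F ∷ [])) refl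

ℰ-obstruct : Obstruction (blowups ℰ)
ℰ-obstruct = blowups-obstruct ℰ refl book 2 8 book-safe (lookup (0F ∷ 1F ∷ 2F ∷ 3F ∷ 4F ∷ 2F ∷ 3F ∷ 4F ∷ [])) refl

-- Nodes 2 and 3 share a class, whose edge is the matched one.
𝒬-obstruct : Obstruction (blowups 𝒬)
𝒬-obstruct = blowups-obstruct 𝒬 refl book 2 8 book-safe (lookup (0F ∷ 1F ∷ 2F ∷ 2F ∷ 3F ∷ 4F ∷ [])) refl

star-obstruct : Obstruction (ladders star)
star-obstruct = ladders-obstruct star refl

triangle-obstruct : Obstruction (ladders triangle)
triangle-obstruct = ladders-obstruct triangle refl

-- Case analysis on the pair of graphs.

Conclusion : Graph → Graph → Set
Conclusion H₁ H₂ =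
  Le₂ H₁ H₂ K₁₃ Z₄ ⊎ Le₂ H₁ H₂ K₁₃ B₁₂ ⊎ Le₂ H₁ H₂ K₁₃ N₁₁₁ ⊎
  Le₂ H₁ H₂ P₄ W ⊎ Le₂ H₁ H₂ K₁₃* Z₁ ⊎ Le₂ H₁ H₂ P₅ W* ⊎ Le₂ H₁ H₂ P₅ K₄⁻

Le₂-swap : ∀ H₁ H₂ A B → Le₂ H₁ H₂ A B → Le₂ H₂ H₁ A B
Le₂-swap H₁ H₂ A B (a , b) = swap a , swap b

Conclusion-swap : ∀ H₁ H₂ → Conclusion H₁ H₂ → Conclusion H₂ H₁
Conclusion-swap H₁ H₂ = Sum.map (s K₁₃ Z₄) (Sum.map (s K₁₃ B₁₂) (Sum.map (s K₁₃ N₁₁₁)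
  (Sum.map (s P₄ W) (Sum.map (s K₁₃* Z₁) (Sum.map (s P₅ W*) (s P₅ K₄⁻))))))
  where s = Le₂-swap H₁ H₂

-- n stands for the bound n₀ of the theorem.
Covers : ℕ → Graph → Graph → Set
Covers n H₁ H₂ = ∀ G → Obstruction G → H₁ ≺ G n ⊎ H₂ ≺ G n

sole : ∀ {H G} → Any (H ≺_) (G ∷ []) → H ≺ G
sole (here H≺G) = H≺G

claw-case : ∀ n A B → Nonempty A → Nonempty B → Covers n A B → A ≺ K₁₃ → Conclusion A B
claw-case n A B neA neB covers A≺K₁₃ =
  split (covers (blowups 𝒞₂) 𝒞₂-obstruct) (covers (blowups 𝒞₃) 𝒞₃-obstruct)
        (covers (ladders triangle) triangle-obstruct)
  where
  -- A claw-free connected part of the claw lies in `P₃`, which is contained in `Z₄` as well, so `A`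
  -- serves both targets.
  claw-free : ∀ {G} → A ≺ G → Avoiding G (K₁₃ ∷ []) → Conclusion A B
  claw-free {G} A≺G free = inj₁ (inj₁ A≺K₁₃ , inj₁ (≺-trans {A} {P₃} {Z₄} A≺P₃ (embeds-sound P₃ Z₄ _)))
    where
    A≺P₃ : A ≺ P₃
    A≺P₃ = sole {A} {P₃} (force-P₃ A neA (++⁺
      (inherit {A} {K₁₃} A≺K₁₃ (graph-avoids K₁₃ (K₃ ∷ C₄ ∷ P₄ ∷ []) refl)) (inherit {A} {G} A≺G free)))
  options : Any (B ≺_) (Z₄ ∷ B₁₂ ∷ N₁₁₁ ∷ []) → Conclusion A B
  options (here z)                 = inj₁ (inj₁ A≺K₁₃ , inj₂ z)
  options (there (here b))         = inj₂ (inj₁ (inj₁ A≺K₁₃ , inj₂ b))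
  options (there (there (here c))) = inj₂ (inj₂ (inj₁ (inj₁ A≺K₁₃ , inj₂ c)))
  split : A ≺ blowups 𝒞₂ n ⊎ B ≺ blowups 𝒞₂ n → A ≺ blowups 𝒞₃ n ⊎ B ≺ blowups 𝒞₃ n →
          A ≺ ladders triangle n ⊎ B ≺ ladders triangle n → Conclusion A B
  split (inj₁ a) _ _ = claw-free {blowups 𝒞₂ n} a (blowups-avoid 𝒞₂ (K₁₃ ∷ []) refl n)
  split _ (inj₁ a) _ = claw-free {blowups 𝒞₃ n} a (blowups-avoid 𝒞₃ (K₁₃ ∷ []) refl n)
  split _ _ (inj₁ a) = claw-free {ladders triangle n} a (ladders-avoid triangle (K₁₃ ∷ []) refl n)
  split (inj₂ b₂) (inj₂ b₃) (inj₂ bₜ) = options (force-Z₄-B₁₂-N₁₁₁ B neB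
    (++⁺ (inherit {B} {blowups 𝒞₂ n} b₂ (blowups-avoid 𝒞₂ (K₁₃ ∷ K₄⁻ ∷ C₅ ∷ C₆ ∷ C₇ ∷ P₇ ∷ B₁₃ ∷ N₁₁₂ ∷ []) refl n))
    (++⁺ (inherit {B} {blowups 𝒞₃ n} b₃ (blowups-avoid 𝒞₃ (C₄ ∷ B₂₂ ∷ []) refl n))
         (inherit {B} {ladders triangle n} bₜ (ladders-avoid triangle (K₄ ∷ TT₀ ∷ TT₁ ∷ TT₂ ∷ TT₃ ∷ []) refl n)))))

main-case : ∀ n A B → Nonempty A → Nonempty B → Covers n A B →
            ¬ (A ≺ K₁₃) → ¬ (B ≺ K₁₃) → B ≺ blowups 𝒟 n → Conclusion A B
main-case n A B neA neB covers A⊀K₁₃ B⊀K₁₃ B≺𝒟 =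
  split (covers (blowups 𝒞₂) 𝒞₂-obstruct) (covers (ladders triangle) triangle-obstruct)
  where
  -- Without triangles, the exclusions of `𝒟` would make `B` a star with at most three leaves.
  B-not-triangle-free : ∀ {G} → Avoiding G (K₃ ∷ []) → ¬ (B ≺ G)
  B-not-triangle-free {G} free B≺G = B⊀K₁₃ (sole {B} {K₁₃} (force-K₁₃ B neB
    (++⁺ (inherit {B} {G} B≺G free) (inherit {B} {blowups 𝒟 n} B≺𝒟 (blowups-avoid 𝒟 (C₄ ∷ P₄ ∷ K₁₄ ∷ []) refl n)))))
  A-in : ∀ {G} → Obstruction G → Avoiding (G n) (K₃ ∷ []) → A ≺ G n
  A-in {G} ob free = [ id , (λ B≺G → contradiction B≺G (B-not-triangle-free {G n} free)) ]′ (covers G ob)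
  A≺K₁₃* : A ≺ K₁₃*
  A≺K₁₃* = sole {A} {K₁₃*} (force-K₁₃* A neA (++⁺
    (inherit {A} {blowups ℰ n} (A-in {blowups ℰ} ℰ-obstruct (blowups-avoid ℰ (K₃ ∷ []) refl n))
      (blowups-avoid ℰ (K₃ ∷ C₅ ∷ C₆ ∷ P₆ ∷ S₁₁₃ ∷ H₂₂ ∷ []) refl n))
    (inherit {A} {ladders star n} (A-in {ladders star} star-obstruct (ladders-avoid star (K₃ ∷ []) refl n))
      (ladders-avoid star (C₄ ∷ K₁₄ ∷ []) refl n))))
  -- `A` lies in the tree `K₁₃*`; without `P₄` it would be a star within the claw.
  A-not-P₄-free : ∀ {G} → Avoiding G (P₄ ∷ []) → ¬ (A ≺ G)
  A-not-P₄-free {G} free A≺G = A⊀K₁₃ (sole {A} {K₁₃} (force-K₁₃ A neA (++⁺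
    (inherit {A} {K₁₃*} A≺K₁₃* (graph-avoids K₁₃* (K₃ ∷ C₄ ∷ []) refl)) (++⁺
    (inherit {A} {G} A≺G free) (inherit {A} {K₁₃*} A≺K₁₃* (graph-avoids K₁₃* (K₁₄ ∷ []) refl))))))
  B-in : ∀ {G} → Obstruction G → Avoiding (G n) (P₄ ∷ []) → B ≺ G n
  B-in {G} ob free = [ (λ A≺G → contradiction A≺G (A-not-P₄-free {G n} free)) , id ]′ (covers G ob)
  B-options : Any (B ≺_) (W ∷ K₄⁻ ∷ [])
  B-options = force-W-K₄⁻ B neB (++⁺
    (inherit {B} {blowups 𝒟 n} B≺𝒟 (blowups-avoid 𝒟 (P₄ ∷ C₄ ∷ K₁₄ ∷ dart ∷ []) refl n)) (++⁺
    (inherit {B} {blowups 𝒮 n} (B-in {blowups 𝒮} 𝒮-obstruct (blowups-avoid 𝒮 (P₄ ∷ []) refl n))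
      (blowups-avoid 𝒮 (K₄ ∷ []) refl n))
    (inherit {B} {blowups ℬ n} (B-in {blowups ℬ} ℬ-obstruct (blowups-avoid ℬ (P₄ ∷ []) refl n))
      (blowups-avoid ℬ (K₂+3K₁ ∷ []) refl n))))
  P₅-case : A ≺ P₅ → Any (B ≺_) (W ∷ K₄⁻ ∷ []) → Conclusion A B
  P₅-case A≺P₅ (there (here B≺K₄⁻)) = inj₂ (inj₂ (inj₂ (inj₂ (inj₂ (inj₂ (inj₁ A≺P₅ , inj₂ B≺K₄⁻))))))
  -- `𝒬` contains neither `P₅` nor `W`, so whichever graph embeds there shrinks to `P₄` or `W*`
  -- respectively.
  P₅-case A≺P₅ (here B≺W) = [ P₄-case , W*-case ]′ (covers (blowups 𝒬) 𝒬-obstruct)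
    where
    P₄-case : A ≺ blowups 𝒬 n → Conclusion A B
    P₄-case A≺𝒬 = inj₂ (inj₂ (inj₂ (inj₁ (inj₁ A≺P₄ , inj₂ B≺W))))
      where
      A≺P₄ : A ≺ P₄
      A≺P₄ = sole {A} {P₄} (force-P₄ A neA (++⁺
        (inherit {A} {P₅} A≺P₅ (graph-avoids P₅ (K₃ ∷ C₄ ∷ C₅ ∷ K₁₃ ∷ []) refl))
        (inherit {A} {blowups 𝒬 n} A≺𝒬 (blowups-avoid 𝒬 (P₅ ∷ []) refl n))))
    W*-case : B ≺ blowups 𝒬 n → Conclusion A B
    W*-case B≺𝒬 = inj₂ (inj₂ (inj₂ (inj₂ (inj₂ (inj₁ (inj₁ A≺P₅ , inj₂ B≺W*))))))
      where
      B≺W* : B ≺ W*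
      B≺W* = sole {B} {W*} (force-W* B neB (++⁺
        (inherit {B} {W} B≺W (graph-avoids W (P₄ ∷ C₄ ∷ K₁₄ ∷ K₄ ∷ K₄⁻ ∷ []) refl))
        (inherit {B} {blowups 𝒬 n} B≺𝒬 (blowups-avoid 𝒬 (W ∷ []) refl n))))
  claw-free : ∀ {G} → A ≺ G → Avoiding G (K₁₃ ∷ []) → Conclusion A B
  claw-free {G} A≺G free = P₅-case (sole {A} {P₅} (force-P₅ A neA (++⁺
    (inherit {A} {K₁₃*} A≺K₁₃* (graph-avoids K₁₃* (K₃ ∷ C₄ ∷ C₅ ∷ C₆ ∷ P₆ ∷ []) refl))
    (inherit {A} {G} A≺G free)))) B-options
  split : A ≺ blowups 𝒞₂ n ⊎ B ≺ blowups 𝒞₂ n → A ≺ ladders triangle n ⊎ B ≺ ladders triangle n → Conclusion A B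
  split (inj₁ a) _ = claw-free {blowups 𝒞₂ n} a (blowups-avoid 𝒞₂ (K₁₃ ∷ []) refl n)
  split _ (inj₁ a) = claw-free {ladders triangle n} a (ladders-avoid triangle (K₁₃ ∷ []) refl n)
  split (inj₂ b₂) (inj₂ bₜ) = inj₂ (inj₂ (inj₂ (inj₂ (inj₁ (inj₁ A≺K₁₃* , inj₂ B≺Z₁)))))
    where
    B≺Z₁ : B ≺ Z₁
    B≺Z₁ = sole {B} {Z₁} (force-Z₁ B neB (++⁺
      (inherit {B} {blowups 𝒟 n} B≺𝒟 (blowups-avoid 𝒟 (P₄ ∷ C₄ ∷ []) refl n)) (++⁺
      (inherit {B} {blowups 𝒞₂ n} b₂ (blowups-avoid 𝒞₂ (K₁₃ ∷ K₄⁻ ∷ []) refl n))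
      (inherit {B} {ladders triangle n} bₜ (ladders-avoid triangle (K₄ ∷ TT₀ ∷ []) refl n)))))

theorem1 : (H₁ H₂ : Graph) →
    ¬ (H₁ ≅ H₂) →
    Connected H₁ → Connected H₂ →
    3 ≤ order H₁ → 3 ≤ order H₂ →
    Σ ℕ (λ n₀ → (1 ≤ n₀) × ((G : Graph) → TwoConnected G → Free₂ H₁ H₂ G →
    n₀ ≤ order G → HasDominatingCycle G)) →
    Le₂ H₁ H₂ K₁₃ Z₄ ⊎ Le₂ H₁ H₂ K₁₃ B₁₂ ⊎ Le₂ H₁ H₂ K₁₃ N₁₁₁ ⊎
    Le₂ H₁ H₂ P₄ W ⊎ Le₂ H₁ H₂ K₁₃* Z₁ ⊎ Le₂ H₁ H₂ P₅ W* ⊎ Le₂ H₁ H₂ P₅ K₄⁻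
theorem1 H₁ H₂ _ conn₁ conn₂ 3≤₁ 3≤₂ (n₀ , _ , dominated) = decide (H₁ ≺? K₁₃) (H₂ ≺? K₁₃)
  where
  ne₁ : Nonempty H₁
  ne₁ = conn₁ , ℕₚ.≤-trans (s≤s z≤n) 3≤₁
  ne₂ : Nonempty H₂
  ne₂ = conn₂ , ℕₚ.≤-trans (s≤s z≤n) 3≤₂
  covers : Covers n₀ H₁ H₂
  covers G ob = found (H₁ ≺? G n₀) (H₂ ≺? G n₀)
    where
    found : Dec (H₁ ≺ G n₀) → Dec (H₂ ≺ G n₀) → H₁ ≺ G n₀ ⊎ H₂ ≺ G n₀
    found (yes H₁≺G) _          = inj₁ H₁≺G
    found (no _)     (yes H₂≺G) = inj₂ H₂≺G
    -- Otherwise `G n₀` would contradict the hypothesis.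
    found (no H₁⊀G)  (no H₂⊀G)  = let two , large , undominated = ob n₀ in
      contradiction (dominated (G n₀) two (H₁⊀G , H₂⊀G) large) undominated
  covers′ : Covers n₀ H₂ H₁
  covers′ G = swap ∘ covers G
  decide : Dec (H₁ ≺ K₁₃) → Dec (H₂ ≺ K₁₃) → Conclusion H₁ H₂
  decide (yes H₁≺K₁₃) _ = claw-case n₀ H₁ H₂ ne₁ ne₂ covers H₁≺K₁₃
  decide _ (yes H₂≺K₁₃) = Conclusion-swap H₂ H₁ (claw-case n₀ H₂ H₁ ne₂ ne₁ covers′ H₂≺K₁₃)
  decide (no H₁⊀K₁₃) (no H₂⊀K₁₃) =
    -- The graph found in `𝒟` takes the role of `B`.
    [ (λ H₁≺𝒟 → Conclusion-swap H₂ H₁ (main-case n₀ H₂ H₁ ne₂ ne₁ covers′ H₂⊀K₁₃ H₁⊀K₁₃ H₁≺𝒟))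
    , main-case n₀ H₁ H₂ ne₁ ne₂ covers H₁⊀K₁₃ H₂⊀K₁₃ ]′ (covers (blowups 𝒟) 𝒟-obstruct)
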